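{- Let $d\geq 1$ and $m\geq 2$ be integers. (a) Let $r\geq 3$ and $k\geq 0$ be integers, and let $n=(r-1)(d+m+1)+k+1$. If $\ell$ is an integer with $\ell>2+\frac{k+2}{r-2}$, then there exists a set $X$ of $n+\ell$ affinely spanning points in $\mathbb{R}^{n-d-1}$ and an $m$-coloring of $X$ which cannot be equidistributed by any conical $r$-fan in $\mathbb{R}^{n-d-1}$. (b) Let $k\geq 0$ be an integer and let $n=2(d+1)+m+k$. If $\ell$ is an integer with $\ell>k+3$, then there exists a set $X$ of $n+\ell$ complex affinely spanning points in $\mathbb{C}^{n-d-1}$ and an $m$-coloring of $X$ which cannot be equidistributed by any complex regular $2$-fan in $\mathbb{C}^{n-d-1}$.
   Context: A set of points in $\mathbb{R}^D$ (resp. $\mathbb{C}^D$) is affinely spanning (resp. complex affinely spanning) if it is not contained in a real (resp. complex) affine hyperplane. An $m$-coloring of a finite set $X$ is a partition $X=X_1\sqcup\cdots\sqcup X_m$ into $m$ non-empty subsets. Fans. A $k'$-flat is a $k'$-dimensional affine subspace of $\mathbb{R}^D$ ($1\le k'\le D-1$). If $A$ is a $k'$-flat and $H$ is an affine hyperplane which intersects but does not contain $A$, then $B=A\cap H^+$, with $H^+$ a closed half-space of $H$, is a (closed) half $k'$-flat; its boundary is $\partial B=A\cap H$. An $r$-fan is a union $F_r=\bigcup_{j=1}^r B_j$ of $r$ half $k'$-flats which all have the same boundary $C$, a $(k'-1)$-flat called the center. Write $\mathrm{Int}(B_j)=B_j\setminus C$. An $r$-fan equidistributes an $m$-coloring $X=X_1\sqcup\cdots\sqcup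 X_m$ if $X\subseteq F_r$ and $|\mathrm{Int}(B_j)\cap X_i|\leq |X_i|/r$ for all $1\le j\le r$ and $1\le i\le m$. Conical fans. Let $H_1,\ldots,H_r$ be oriented affine hyperplanes in $\mathbb{R}^D$ (each with a designated closed half-space $H_j^+$) such that (1) the normal vectors of any $r-1$ of them are linearly independent, and (2) the normal vectors of all $r$ of them are linearly dependent and $\bigcap_{i=1}^r H_i\neq\emptyset$. With indices taken cyclically mod $r$, let $A_j=\bigcap_{i\neq j-1,j}H_i$ and $B_j=H_j^+\cap A_j$. Then $F_r=\bigcup_{j=1}^r B_j$ is an $r$-fan of codimension $r-2$ with center $\bigcap_{i=1}^r H_i$; such an $r$-fan is called conical. Complex regular $2$-fans. A complex regular $2$-fan in $\mathbb{C}^D\cong\mathbb{R}^{2D}$ is a real affine hyperplane written as the union $B_1\cup B_2$ of two closed half-hyperplanes whose common boundary (the center) is a complex affine hyperplane. Equivalently, with $\langle u,w\rangle=\sum_i u_i\overline{w_i}$, there are $\alpha\in\mathbb{C}^D\setminus\{0\}$, $\beta\in\mathbb{C}$ with $B_j=\{z\in\mathbb{C}^D\mid \langle\alpha,z\rangle=\beta+t(-1)^j\text{ for some real }t\geq 0\}$ for $j=1,2$. -}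

module Defs where

open import Algebra.Bundles using (RawRing)
import Algebra.Definitions.RawMonoid as RawMonoidDefinitions
open import Data.Fin.Base using (Fin; zero; suc; fromℕ; inject₁)
open import Data.Fin.Properties using (_≟_)
open import Data.Fin.Subset using (Subset; ∣_∣) renaming (_∈_ to _∈ˢ_)
open import Data.Nat.Base as ℕ using (ℕ; zero; suc; _∸_)
import Data.Nat.Properties as ℕ
open import Data.Product using (Σ-syntax; ∃-syntax; _×_; _,_)
open import Data.Rational.Base as ℚ using (ℚ; 0ℚ; 1ℚ; ½)
import Data.Rational.Properties as ℚ
open import Data.Rational.Solver using (module +-*-Solver)
open import Data.Vec.Base using (tabulate)
open import Function.Base using (_∘_)
open import Function.Definitions using (Injective; Surjective)
open import Level using (0ℓ)
open import Relation.Binary.PropositionalEquality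
open import Relation.Nullary using (¬_; does)
open import Relation.Unary using (Pred; _∈_; _∩_; _∖_; ⋃; ⋂; Satisfiable)

------------------------------------------------------------------------
-- Real numbers

-- Since ∃ is Σ, a Cauchy sequence carries a modulus of convergence; this is
-- the usual constructive presentation of ℝ, considered up to _≈ʳ_.

Cauchy : (ℕ → ℚ) → Set
Cauchy f = ∀ ε → 0ℚ ℚ.< ε → ∃[ N ] (∀ m n → N ℕ.≤ m → N ℕ.≤ n →
             ℚ.∣ f m ℚ.- f n ∣ ℚ.< ε)

record ℝ : Set where
  constructor mkℝ
  field
    seq    : ℕ → ℚ
    cauchy : Cauchy seq

open ℝ public

infix 4 _≈ʳ_ _≤ʳ_

_≈ʳ_ : ℝ → ℝ → Set
x ≈ʳ y = ∀ ε → 0ℚ ℚ.< ε → ∃[ N ] (∀ n → N ℕ.≤ n →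
           ℚ.∣ seq x n ℚ.- seq y n ∣ ℚ.< ε)

_≤ʳ_ : ℝ → ℝ → Set
x ≤ʳ y = ∀ ε → 0ℚ ℚ.< ε → ∃[ N ] (∀ n → N ℕ.≤ n →
           seq x n ℚ.< seq y n ℚ.+ ε)

module CauchySequences where

  abstract

    ½-pos : ∀ {ε} → 0ℚ ℚ.< ε → 0ℚ ℚ.< ½ ℚ.* ε
    ½-pos {ε} 0<ε = subst (ℚ._< ½ ℚ.* ε) (ℚ.*-zeroʳ ½) (ℚ.*-monoʳ-<-pos ½ 0<ε)

    ½+½ : ∀ ε → ½ ℚ.* ε ℚ.+ ½ ℚ.* ε ≡ ε
    ½+½ ε = trans (sym (ℚ.*-distribʳ-+ ε ½ ½)) (ℚ.*-identityˡ ε)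

    const-cauchy : ∀ q → Cauchy (λ _ → q)
    const-cauchy q ε 0<ε = 0 , λ _ _ _ _ →
      subst (ℚ._< ε) (sym (cong ℚ.∣_∣ (ℚ.+-inverseʳ q))) 0<ε

    +-cauchy : ∀ f g → Cauchy f → Cauchy g → Cauchy (λ n → f n ℚ.+ g n)
    +-cauchy f g F G ε 0<ε
      with F (½ ℚ.* ε) (½-pos 0<ε) | G (½ ℚ.* ε) (½-pos 0<ε)
    ... | M , P | N , Q = M ℕ.⊔ N , λ m n m≥ n≥ → begin-strict
      ℚ.∣ (f m ℚ.+ g m) ℚ.- (f n ℚ.+ g n) ∣
        ≡⟨ cong ℚ.∣_∣ (rearrange (f m) (g m) (f n) (g n)) ⟩
      ℚ.∣ (f m ℚ.- f n) ℚ.+ (g m ℚ.- g n) ∣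
        ≤⟨ ℚ.∣p+q∣≤∣p∣+∣q∣ (f m ℚ.- f n) (g m ℚ.- g n) ⟩
      ℚ.∣ f m ℚ.- f n ∣ ℚ.+ ℚ.∣ g m ℚ.- g n ∣
        <⟨ ℚ.+-mono-<
             (P m n (ℕ.≤-trans (ℕ.m≤m⊔n M N) m≥) (ℕ.≤-trans (ℕ.m≤m⊔n M N) n≥))
             (Q m n (ℕ.≤-trans (ℕ.m≤n⊔m M N) m≥) (ℕ.≤-trans (ℕ.m≤n⊔m M N) n≥)) ⟩
      ½ ℚ.* ε ℚ.+ ½ ℚ.* ε
        ≡⟨ ½+½ ε ⟩
      ε ∎
      where
      open ℚ.≤-Reasoning
      rearrange : ∀ a b c d →
        (a ℚ.+ b) ℚ.- (c ℚ.+ d) ≡ (a ℚ.- c) ℚ.+ (b ℚ.- d)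
      rearrange = solve 4 (λ a b c d →
        (a :+ b) :- (c :+ d) := (a :- c) :+ (b :- d)) refl
        where open +-*-Solver

    neg-cauchy : ∀ f → Cauchy f → Cauchy (λ n → ℚ.- f n)
    neg-cauchy f F ε 0<ε with F ε 0<ε
    ... | N , P = N , λ m n m≥ n≥ → subst (ℚ._< ε)
      (trans (sym (ℚ.∣-p∣≡∣p∣ (f m ℚ.- f n)))
             (cong ℚ.∣_∣ (ℚ.neg-distrib-+ (f m) (ℚ.- f n))))
      (P m n m≥ n≥)

    eventually-bounded : ∀ {f} → Cauchy f →
      ∃[ K ] (ℚ.Positive K × (∃[ N ] (∀ n → N ℕ.≤ n → ℚ.∣ f n ∣ ℚ.≤ K)))
    eventually-bounded {f} F with F 1ℚ (ℚ.positive⁻¹ 1ℚ)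
    ... | N , P = ℚ.∣ f N ∣ ℚ.+ 1ℚ
                , ℚ.nonNeg+pos⇒pos ℚ.∣ f N ∣ {{ℚ.∣-∣-nonNeg (f N)}} 1ℚ
                , N , bound
      where
      open ℚ.≤-Reasoning
      split : ∀ a b → a ≡ b ℚ.+ (a ℚ.- b)
      split = solve 2 (λ a b → a := b :+ (a :- b)) refl
        where open +-*-Solver
      bound : ∀ n → N ℕ.≤ n → ℚ.∣ f n ∣ ℚ.≤ ℚ.∣ f N ∣ ℚ.+ 1ℚ
      bound n n≥ = begin
        ℚ.∣ f n ∣                        ≡⟨ cong ℚ.∣_∣ (split (f n) (f N)) ⟩
        ℚ.∣ f N ℚ.+ (f n ℚ.- f N) ∣      ≤⟨ ℚ.∣p+q∣≤∣p∣+∣q∣ (f N) (f n ℚ.- f N) ⟩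
        ℚ.∣ f N ∣ ℚ.+ ℚ.∣ f n ℚ.- f N ∣  ≤⟨ ℚ.+-monoʳ-≤ ℚ.∣ f N ∣
                                             (ℚ.<⇒≤ (P n N n≥ ℕ.≤-refl)) ⟩
        ℚ.∣ f N ∣ ℚ.+ 1ℚ                 ∎

    small : ∀ K .{{_ : ℚ.Positive K}} {ε} → 0ℚ ℚ.< ε →
      ∃[ δ ] (0ℚ ℚ.< δ × K ℚ.* δ ≡ ½ ℚ.* ε)
    small K {ε} 0<ε = 1/K ℚ.* (½ ℚ.* ε)
      , subst (ℚ._< 1/K ℚ.* (½ ℚ.* ε)) (ℚ.*-zeroʳ 1/K)
          (ℚ.*-monoʳ-<-pos 1/K {{ℚ.1/pos⇒pos K}} (½-pos 0<ε))
      , trans (sym (ℚ.*-assoc K 1/K (½ ℚ.* ε)))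
          (trans (cong (ℚ._* (½ ℚ.* ε)) (ℚ.*-inverseʳ K {{ℚ.pos⇒nonZero K}}))
            (ℚ.*-identityˡ (½ ℚ.* ε)))
      where
      1/K : ℚ
      1/K = ℚ.1/_ K {{ℚ.pos⇒nonZero K}}

    *-bound : ∀ K δ a b → ℚ.Positive K →
      ℚ.∣ a ∣ ℚ.≤ K → ℚ.∣ b ∣ ℚ.< δ → ℚ.∣ a ℚ.* b ∣ ℚ.< K ℚ.* δ
    *-bound K δ a b K>0 a≤ b< = begin-strict
      ℚ.∣ a ℚ.* b ∣        ≡⟨ ℚ.∣p*q∣≡∣p∣*∣q∣ a b ⟩
      ℚ.∣ a ∣ ℚ.* ℚ.∣ b ∣  ≤⟨ ℚ.*-monoʳ-≤-nonNeg ℚ.∣ b ∣ {{ℚ.∣-∣-nonNeg b}} a≤ ⟩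
      K ℚ.* ℚ.∣ b ∣        <⟨ ℚ.*-monoʳ-<-pos K {{K>0}} b< ⟩
      K ℚ.* δ              ∎
      where open ℚ.≤-Reasoning

    *-difference : ∀ a b c d →
      ℚ.∣ a ℚ.* b ℚ.- c ℚ.* d ∣ ℚ.≤
      ℚ.∣ a ℚ.* (b ℚ.- d) ∣ ℚ.+ ℚ.∣ d ℚ.* (a ℚ.- c) ∣
    *-difference a b c d = subst
      (λ q → ℚ.∣ q ∣ ℚ.≤ ℚ.∣ a ℚ.* (b ℚ.- d) ∣ ℚ.+ ℚ.∣ d ℚ.* (a ℚ.- c) ∣)
      (rearrange a b c d)
      (ℚ.∣p+q∣≤∣p∣+∣q∣ (a ℚ.* (b ℚ.- d)) (d ℚ.* (a ℚ.- c)))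
      where
      rearrange : ∀ a b c d →
        a ℚ.* (b ℚ.- d) ℚ.+ d ℚ.* (a ℚ.- c) ≡ a ℚ.* b ℚ.- c ℚ.* d
      rearrange = solve 4 (λ a b c d →
        a :* (b :- d) :+ d :* (a :- c) := a :* b :- c :* d) refl
        where open +-*-Solver

    *-cauchy : ∀ f g → Cauchy f → Cauchy g → Cauchy (λ n → f n ℚ.* g n)
    *-cauchy f g F G ε 0<ε =
      let K , K>0 , M₁ , B₁ = eventually-bounded F
          L , L>0 , M₂ , B₂ = eventually-bounded G
          δ , 0<δ , Kδ = small K {{K>0}} 0<ε
          η , 0<η , Lη = small L {{L>0}} 0<ε
          M₃ , P = G δ 0<δ
          M₄ , Q = F η 0<η
          M₁₂ = M₁ ℕ.⊔ M₂
          M₃₄ = M₃ ℕ.⊔ M₄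
      in M₁₂ ℕ.⊔ M₃₄ , λ m n m≥ n≥ →
        let m≥₁  = ℕ.m⊔n≤o⇒m≤o M₁ M₂ (ℕ.m⊔n≤o⇒m≤o M₁₂ M₃₄ m≥)
            n≥₂  = ℕ.m⊔n≤o⇒n≤o M₁ M₂ (ℕ.m⊔n≤o⇒m≤o M₁₂ M₃₄ n≥)
            m≥₃₄ = ℕ.m⊔n≤o⇒n≤o M₁₂ M₃₄ m≥
            n≥₃₄ = ℕ.m⊔n≤o⇒n≤o M₁₂ M₃₄ n≥
            p = *-bound K δ (f m) (g m ℚ.- g n) K>0 (B₁ m m≥₁)
                  (P m n (ℕ.m⊔n≤o⇒m≤o M₃ M₄ m≥₃₄) (ℕ.m⊔n≤o⇒m≤o M₃ M₄ n≥₃₄))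
            q = *-bound L η (g n) (f m ℚ.- f n) L>0 (B₂ n n≥₂)
                  (Q m n (ℕ.m⊔n≤o⇒n≤o M₃ M₄ m≥₃₄) (ℕ.m⊔n≤o⇒n≤o M₃ M₄ n≥₃₄))
        in ℚ.≤-<-trans (*-difference (f m) (g m) (f n) (g n))
             (subst (_ ℚ.<_) (trans (cong₂ ℚ._+_ Kδ Lη) (½+½ ε)) (ℚ.+-mono-< p q))

open CauchySequences using (const-cauchy; +-cauchy; *-cauchy; neg-cauchy)

infixl 6 _+ʳ_
infixl 7 _*ʳ_
infix  8 -ʳ_

ι : ℚ → ℝ
ι q = mkℝ (λ _ → q) (const-cauchy q)

_+ʳ_ : ℝ → ℝ → ℝ
x +ʳ y = mkℝ (λ n → seq x n ℚ.+ seq y n) (+-cauchy (seq x) (seq y) (cauchy x) (cauchy y))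

_*ʳ_ : ℝ → ℝ → ℝ
x *ʳ y = mkℝ (λ n → seq x n ℚ.* seq y n) (*-cauchy (seq x) (seq y) (cauchy x) (cauchy y))

-ʳ_ : ℝ → ℝ
-ʳ x = mkℝ (λ n → ℚ.- seq x n) (neg-cauchy (seq x) (cauchy x))

0ʳ 1ʳ : ℝ
0ʳ = ι 0ℚ
1ʳ = ι 1ℚ

ℝ-rawRing : RawRing 0ℓ 0ℓ
ℝ-rawRing = record
  { Carrier = ℝ ; _≈_ = _≈ʳ_ ; _+_ = _+ʳ_ ; _*_ = _*ʳ_ ; -_ = -ʳ_
  ; 0# = 0ʳ ; 1# = 1ʳ }

------------------------------------------------------------------------
-- Complex numbers

infix  4 _≈ᶜ_
infixl 6 _+ᶜ_
infixl 7 _*ᶜ_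
infix  8 -ᶜ_

record ℂ : Set where
  constructor _+i_
  field
    re im : ℝ

open ℂ public

_≈ᶜ_ : ℂ → ℂ → Set
z ≈ᶜ w = re z ≈ʳ re w × im z ≈ʳ im w

_+ᶜ_ : ℂ → ℂ → ℂ
z +ᶜ w = (re z +ʳ re w) +i (im z +ʳ im w)

_*ᶜ_ : ℂ → ℂ → ℂ
z *ᶜ w = (re z *ʳ re w +ʳ -ʳ (im z *ʳ im w)) +i (re z *ʳ im w +ʳ im z *ʳ re w)

-ᶜ_ : ℂ → ℂ
-ᶜ z = (-ʳ re z) +i (-ʳ im z)

conj : ℂ → ℂ
conj z = re z +i (-ʳ im z)

fromReal : ℝ → ℂ
fromReal t = t +i 0ʳ

0ᶜ 1ᶜ : ℂ
0ᶜ = fromReal 0ʳ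
1ᶜ = fromReal 1ʳ

ℂ-rawRing : RawRing 0ℓ 0ℓ
ℂ-rawRing = record
  { Carrier = ℂ ; _≈_ = _≈ᶜ_ ; _+_ = _+ᶜ_ ; _*_ = _*ᶜ_ ; -_ = -ᶜ_
  ; 0# = 0ᶜ ; 1# = 1ᶜ }

open RawMonoidDefinitions (RawRing.+-rawMonoid ℝ-rawRing) public
  using () renaming (sum to sumʳ)
open RawMonoidDefinitions (RawRing.+-rawMonoid ℂ-rawRing) public
  using () renaming (sum to sumᶜ)

------------------------------------------------------------------------
-- Affine geometry of ℝ^D and ℂ^D

infix 8 ℝ^_ ℂ^_
infix 4 _≋ʳ_ _≋ᶜ_

ℝ^_ ℂ^_ : ℕ → Set
ℝ^ D = Fin D → ℝ
ℂ^ D = Fin D → ℂ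

_≋ʳ_ : ∀ {D} → ℝ^ D → ℝ^ D → Set
x ≋ʳ y = ∀ i → x i ≈ʳ y i

_≋ᶜ_ : ∀ {D} → ℂ^ D → ℂ^ D → Set
x ≋ᶜ y = ∀ i → x i ≈ᶜ y i

⟨_,_⟩ʳ : ∀ {D} → ℝ^ D → ℝ^ D → ℝ
⟨ u , w ⟩ʳ = sumʳ (λ i → u i *ʳ w i)

⟨_,_⟩ᶜ : ∀ {D} → ℂ^ D → ℂ^ D → ℂ
⟨ u , w ⟩ᶜ = sumᶜ (λ i → u i *ᶜ conj (w i))

LinearlyIndependent : ∀ {s D} → (Fin s → ℝ^ D) → Set
LinearlyIndependent {s} {D} v = (a : Fin s → ℝ) →
  (∀ (i : Fin D) → sumʳ (λ j → a j *ʳ v j i) ≈ʳ 0ʳ) → ∀ j → a j ≈ʳ 0ʳ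

-- Replacing (normal , offset) by (- normal , - offset) keeps the hyperplane and
-- exchanges its half-spaces, so this record is also an oriented hyperplane.

record RealHyperplane (D : ℕ) : Set where
  field
    normal  : ℝ^ D
    offset  : ℝ
    nonzero : ¬ (normal ≋ʳ λ _ → 0ʳ)

  points : Pred (ℝ^ D) 0ℓ
  points x = ⟨ normal , x ⟩ʳ ≈ʳ offset

  positiveSide : Pred (ℝ^ D) 0ℓ
  positiveSide x = offset ≤ʳ ⟨ normal , x ⟩ʳ

record ComplexHyperplane (D : ℕ) : Set where
  field
    α       : ℂ^ D
    β       : ℂ
    nonzero : ¬ (α ≋ᶜ λ _ → 0ᶜ)

  points : Pred (ℂ^ D) 0ℓ
  points z = ⟨ α , z ⟩ᶜ ≈ᶜ β

------------------------------------------------------------------------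
-- Finite point sets and colorings

-- A set of N points is a family Fin N → E without repetitions.

Distinctʳ : ∀ {N D} → (Fin N → ℝ^ D) → Set
Distinctʳ X = Injective _≡_ _≋ʳ_ X

Distinctᶜ : ∀ {N D} → (Fin N → ℂ^ D) → Set
Distinctᶜ X = Injective _≡_ _≋ᶜ_ X

AffinelySpanning : ∀ {N D} → (Fin N → ℝ^ D) → Set
AffinelySpanning {D = D} X =
  ¬ (Σ[ H ∈ RealHyperplane D ] (∀ p → X p ∈ RealHyperplane.points H))

ComplexAffinelySpanning : ∀ {N D} → (Fin N → ℂ^ D) → Set
ComplexAffinelySpanning {D = D} X =
  ¬ (Σ[ H ∈ ComplexHyperplane D ] (∀ p → X p ∈ ComplexHyperplane.points H))

-- The parts of the partition are the fibres; surjectivity makes them non-empty.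

IsColoring : ∀ {N m} → (Fin N → Fin m) → Set
IsColoring c = Surjective _≡_ _≡_ c

colorClass : ∀ {N m} → (Fin N → Fin m) → Fin m → Subset N
colorClass c i = tabulate (λ p → does (c p ≟ i))

------------------------------------------------------------------------
-- Fans

record Fan (E : Set) (r : ℕ) : Set₁ where
  field
    half   : Fin r → Pred E 0ℓ
    center : Pred E 0ℓ

  support : Pred E 0ℓ
  support = ⋃ (Fin r) half

  interior : Fin r → Pred E 0ℓ
  interior j = half j ∖ center

-- Membership in Int(B_j) is not decidable over ℝ, so Int(B_j) ∩ X_i need not
-- have a computable cardinality: |Int(B_j) ∩ X_i| ≤ |X_i|/r is expressed by
-- bounding the size of every finite set contained in Int(B_j) ∩ X_i.

Equidistributes : ∀ {E : Set} {r N m} →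
  Fan E r → (Fin N → E) → (Fin N → Fin m) → Set
Equidistributes {r = r} {N} F X c =
  (∀ p → X p ∈ Fan.support F) ×
  (∀ j i (S : Subset N) →
     (∀ p → p ∈ˢ S → X p ∈ Fan.interior F j × c p ≡ i) →
     r ℕ.* ∣ S ∣ ℕ.≤ ∣ colorClass c i ∣)

-- j ↦ j - 1 modulo r

cyclicPred : ∀ {r} → Fin r → Fin r
cyclicPred {suc r} zero    = fromℕ r
cyclicPred {suc r} (suc j) = inject₁ j

record ConicalArrangement (r D : ℕ) : Set where
  field
    H : Fin r → RealHyperplane D

  open module H i = RealHyperplane (H i) using (normal; points; positiveSide)

  field
    independent : (e : Fin (r ∸ 1) → Fin r) → Injective _≡_ _≡_ e →
                  LinearlyIndependent (normal ∘ e)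
    dependent   : ¬ LinearlyIndependent normal
    concurrent  : Satisfiable (⋂ (Fin r) points)

  A : Fin r → Pred (ℝ^ D) 0ℓ
  A j x = ∀ i → i ≢ cyclicPred j → i ≢ j → x ∈ points i

  fan : Fan (ℝ^ D) r
  fan = record
    { half   = λ j → positiveSide j ∩ A j
    ; center = ⋂ (Fin r) points
    }

-- The index zero : Fin 2 stands for j = 1, where (-1)^j = -1.

signed : Fin 2 → ℝ → ℝ
signed zero       t = -ʳ t
signed (suc zero) t = t

-- The two halves B_j = { z | ⟨α,z⟩ = β + t(-1)^j for some real t ≥ 0 } make up
-- the real hyperplane Im ⟨α,z⟩ = Im β, cut along the complex one ⟨α,z⟩ = β.

complexRegular2Fan : ∀ {D} → ComplexHyperplane D → Fan (ℂ^ D) 2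
complexRegular2Fan H = record
  { half   = λ j z → ∃[ t ] (0ʳ ≤ʳ t ×
               ⟨ α , z ⟩ᶜ ≈ᶜ β +ᶜ fromReal (signed j t))
  ; center = points
  }
  where open ComplexHyperplane H

{-# OPTIONS --safe #-}
module Submission where

-- The points are the origin, the standard basis and e = d + ℓ extra points.  All
-- color classes but one have fewer than r elements, so equidistribution puts them
-- into the center; in particular the origin is there, and the hyperplanes of the
-- fan are the kernels of linear functionals h_1, ..., h_r.
--
-- For conical fans each extra point closes up a cluster: up to a vector in the
-- center it is minus the sum of at most r - 2 basis vectors, so every h_i sums to
-- zero over the cluster.  The cluster has fewer than r points, so some half-flat
-- misses it.  If h_(j-1) vanishes at the points of the cluster in B_j, then it is
-- non-negative on the cluster, being zero off B_(j-1) and B_j, and so it vanishes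
-- there; the linear relation between the functionals then makes h_(j-2) vanish at
-- the points in B_(j-1).  Going around the cycle from the missed half-flat, all h_i
-- vanish on all clusters.  The bound on ℓ says exactly that e clusters suffice to
-- reach every basis vector outside the center.
--
-- For complex regular 2-fans the extra points are i times basis vectors, up to a
-- real multiple of the first one: a linear functional which is real at v and at i v
-- vanishes at v.

open import Defs
open import Algebra.Bundles using (CommutativeRing)
open import Algebra.Definitions using (Congruent₁; Congruent₂)
import Algebra.Properties.Group as GroupProperties
import Algebra.Properties.Ring as RingProperties
import Algebra.Properties.Semiring.Sum as SemiringSum
open import Data.Bool using (Bool; true; false; if_then_else_)
open import Data.Empty using (⊥)
open import Data.Fin
  using ( Fin; zero; suc; toℕ; fromℕ<; _↑ˡ_; _↑ʳ_; splitAt; combine; remQuot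
        ; punchIn; punchOut)
open import Data.Fin.Induction using (<-weakInduction; >-weakInduction)
open import Data.Fin.Properties
  using ( _≟_; any?; all?; ¬∀⟶∃¬; injective⇒≤; inject₁-injective; fromℕ≢inject₁; toℕ<n; toℕ-fromℕ<
        ; fromℕ<-toℕ; toℕ-injective; toℕ-↑ˡ; splitAt⁻¹-↑ˡ; splitAt⁻¹-↑ʳ; combine-remQuot
        ; punchInᵢ≢i; punchIn-injective; punchIn-punchOut)
open import Data.Fin.Subset using (∣_∣; ⁅_⁆)
open import Data.Fin.Subset.Properties using (∣⁅x⁆∣≡1; x∈⁅y⁆⇒x≡y)
open import Data.Integer as ℤ using (+_)
import Data.Integer.Properties as ℤ
open import Data.Nat as ℕ using (ℕ; zero; suc; z≤n; s≤s; s≤s⁻¹; >-nonZero)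
import Data.Nat.Coprimality as Coprime
import Data.Nat.DivMod as ℕ
import Data.Nat.Properties as ℕ
open import Data.Nat.Properties using (m<n⇒0<n∸m)
import Data.Nat.Solver as ℕ
open import Data.Product using (Σ-syntax; ∃-syntax; _×_; _,_; proj₁; proj₂)
open import Data.Rational as ℚ using (ℚ; mkℚ; 0ℚ; ½; toℚᵘ; _/_)
  renaming (_+_ to _+ℚ_; _<_ to _<ℚ_)
import Data.Rational.Properties as ℚ
import Data.Rational.Solver as ℚ
open import Data.Rational.Unnormalised as ℚᵘ using (mkℚᵘ)
import Data.Rational.Unnormalised.Properties as ℚᵘ
open import Data.Sum using (_⊎_; inj₁; inj₂; [_,_]′; map₂)
open import Data.Vec using (tabulate)
open import Data.Vec.Functional using (_++_; _∷_)
open import Data.Vec.Functional.Properties using (lookup-++ˡ; lookup-++ʳ)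
open import Function.Base using (_∘_; case_of_)
open import Level using (0ℓ)
open import Relation.Binary using (IsEquivalence)
import Relation.Binary.Reasoning.Setoid as SetoidReasoning
open import Relation.Binary.PropositionalEquality as ≡ using (_≡_; _≢_)
open import Relation.Nullary using (¬_; yes; no; does; contradiction; decidable-stable)
open import Relation.Unary using (Pred; _∈_)

-- Inner products and cyclic fans over a commutative ring

cyclicPred-injective : ∀ {r} {i j : Fin r} → cyclicPred i ≡ cyclicPred j → i ≡ j
cyclicPred-injective {suc r} {zero}  {zero}  eq = ≡.refl
cyclicPred-injective {suc r} {zero}  {suc j} eq = contradiction eq fromℕ≢inject₁
cyclicPred-injective {suc r} {suc i} {zero}  eq = contradiction (≡.sym eq) fromℕ≢inject₁
cyclicPred-injective {suc r} {suc i} {suc j} eq = ≡.cong suc (inject₁-injective eq)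

-- Descending from `i` reaches `zero`; its cyclic predecessor is the last index, and a second
-- descent from there passes through all indices.
cyclic-induction : ∀ {r} (P : Pred (Fin r) 0ℓ) → (∀ i → P i → P (cyclicPred i)) →
  ∀ i → P i → ∀ j → P j
cyclic-induction {suc r} P step i Pi = >-weakInduction P (step zero (descend P step i Pi)) (step ∘ suc)
  where
  descend : ∀ {r} (P : Pred (Fin (suc r)) 0ℓ) → (∀ i → P i → P (cyclicPred i)) →
    ∀ i → P i → P zero
  descend P step = <-weakInduction (λ i → P i → P zero) (λ p → p)
    (λ i IH p → IH (step (suc i) p))

-- If every value were attained, a choice of preimages would inject `Fin r` into the smaller
-- `Fin s`.
missed-value : ∀ {s r} → s ℕ.< r → (f : Fin s → Fin r) → ∃[ i ] (∀ u → f u ≢ i)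
missed-value {s} {r} s<r f with all? (λ i → any? (λ u → f u ≟ i))
... | no ¬onto = let i , ¬hit = ¬∀⟶∃¬ r _ (λ i → any? (λ u → f u ≟ i)) ¬onto
                 in i , λ u eq → ¬hit (u , eq)
... | yes onto = contradiction (injective⇒≤ {f = proj₁ ∘ onto} λ {x} {y} eq →
                   ≡.trans (≡.sym (proj₂ (onto x))) (≡.trans (≡.cong f eq) (proj₂ (onto y))))
                   (ℕ.<⇒≱ s<r)

module InnerProduct (R : CommutativeRing 0ℓ 0ℓ) where

  open CommutativeRing R hiding (zero)
  open SemiringSum semiring public
  open RingProperties ring using (-‿distribʳ-*; -‿+-comm; -‿involutive; -0#≈0#)
  open SetoidReasoning setoid

  sum-zero : ∀ {n} (f : Fin n → Carrier) → (∀ i → f i ≈ 0#) → sum f ≈ 0#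
  sum-zero {n} f f≈0 = trans (sum-cong-≋ f≈0) (sum-replicate-zero n)

  sum-single : ∀ {n} (k : Fin n) (f : Fin n → Carrier) →
    (∀ i → i ≢ k → f i ≈ 0#) → sum f ≈ f k
  sum-single {suc n} k f f≈0 = begin
    sum f                      ≈⟨ sum-remove {i = k} f ⟩
    f k + sum (f ∘ punchIn k)  ≈⟨ +-congˡ (sum-zero _ λ i → f≈0 _ (punchInᵢ≢i k i)) ⟩
    f k + 0#                   ≈⟨ +-identityʳ _ ⟩
    f k                        ∎

  sum-neg : ∀ {n} (f : Fin n → Carrier) → sum (λ i → - f i) ≈ - sum f
  sum-neg {zero}  f = sym -0#≈0#
  sum-neg {suc n} f = trans (+-congˡ (sum-neg (f ∘ suc))) (-‿+-comm _ _)

  ⟨_∙_⟩ : ∀ {D} → (Fin D → Carrier) → (Fin D → Carrier) → Carrier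
  ⟨ n ∙ x ⟩ = sum (λ i → n i * x i)

  simplex : ∀ {D} → Fin (suc D) → Fin D → Carrier
  simplex zero    i = 0#
  simplex (suc c) i = if does (i ≟ c) then 1# else 0#

  simplex-diag : ∀ {D} (c : Fin D) → simplex (suc c) c ≡ 1#
  simplex-diag c with c ≟ c
  ... | yes _  = ≡.refl
  ... | no c≢c = contradiction ≡.refl c≢c

  simplex-off : ∀ {D} (p : Fin (suc D)) i → p ≢ suc i → simplex p i ≡ 0#
  simplex-off zero    i _ = ≡.refl
  simplex-off (suc c) i p≢ with i ≟ c
  ... | yes i≡c = contradiction (≡.cong suc (≡.sym i≡c)) p≢
  ... | no _    = ≡.refl

  ∙-zero : ∀ {D} (n x : Fin D → Carrier) → (∀ i → x i ≈ 0#) → ⟨ n ∙ x ⟩ ≈ 0#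
  ∙-zero n x x≈0 = sum-zero _ (λ i → trans (*-congˡ (x≈0 i)) (zeroʳ _))

  ∙-origin : ∀ {D} (n : Fin D → Carrier) → ⟨ n ∙ simplex zero ⟩ ≈ 0#
  ∙-origin n = ∙-zero n _ (λ _ → refl)

  ∙-vertex : ∀ {D} (n : Fin D → Carrier) c → ⟨ n ∙ simplex (suc c) ⟩ ≈ n c
  ∙-vertex n c = begin
    ⟨ n ∙ simplex (suc c) ⟩    ≈⟨ sum-single c _ (λ i i≢c → trans
                                  (*-congˡ (reflexive (simplex-off (suc c) i λ { ≡.refl → i≢c ≡.refl })))
                                  (zeroʳ _)) ⟩
    n c * simplex (suc c) c    ≈⟨ *-congˡ (reflexive (simplex-diag c)) ⟩
    n c * 1#                   ≈⟨ *-identityʳ _ ⟩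
    n c                        ∎

  ∙-+ : ∀ {D} (n x y : Fin D → Carrier) →
    ⟨ n ∙ (λ i → x i + y i) ⟩ ≈ ⟨ n ∙ x ⟩ + ⟨ n ∙ y ⟩
  ∙-+ n x y = trans (sum-cong-≋ (λ i → distribˡ (n i) (x i) (y i)))
                    (∑-distrib-+ (λ i → n i * x i) (λ i → n i * y i))

  ∙-neg : ∀ {D} (n x : Fin D → Carrier) → ⟨ n ∙ (λ i → - x i) ⟩ ≈ - ⟨ n ∙ x ⟩
  ∙-neg {D} n x = trans (sum-cong-≋ {D} (λ i → sym (-‿distribʳ-* (n i) (x i)))) (sum-neg {D} (λ i → n i * x i))

  ∙-scale : ∀ {D} (n : Fin D → Carrier) t x → ⟨ n ∙ (λ i → t * x i) ⟩ ≈ t * ⟨ n ∙ x ⟩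
  ∙-scale {D} n t x = trans
    (sum-cong-≋ {D} (λ i → trans (sym (*-assoc (n i) t (x i)))
      (trans (*-congʳ (*-comm (n i) t)) (*-assoc t (n i) (x i)))))
    (sym (*-distribˡ-sum {D} t (λ i → n i * x i)))

  ∙-sum : ∀ {D s} (n : Fin D → Carrier) (x : Fin s → Fin D → Carrier) →
    ⟨ n ∙ (λ i → sum (λ v → x v i)) ⟩ ≈ sum (λ v → ⟨ n ∙ x v ⟩)
  ∙-sum n x = trans (sum-cong-≋ (λ i → *-distribˡ-sum (n i) (λ v → x v i)))
                    (∑-comm (λ i v → n i * x v i))

  ∙-sumˡ : ∀ {D s} (a : Fin s → Carrier) (n : Fin s → Fin D → Carrier) x →
    (∀ i → sum (λ l → a l * n l i) ≈ 0#) → sum (λ l → a l * ⟨ n l ∙ x ⟩) ≈ 0#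
  ∙-sumˡ a n x dep = begin
    sum (λ l → a l * ⟨ n l ∙ x ⟩)              ≈⟨ sum-cong-≋ (λ l → *-distribˡ-sum (a l) (λ i → n l i * x i)) ⟩
    sum (λ l → sum (λ i → a l * (n l i * x i))) ≈⟨ ∑-comm (λ l i → a l * (n l i * x i)) ⟩
    sum (λ i → sum (λ l → a l * (n l i * x i))) ≈⟨ sum-cong-≋ (λ i → sum-cong-≋ (λ l → sym (*-assoc (a l) (n l i) (x i)))) ⟩
    sum (λ i → sum (λ l → a l * n l i * x i))   ≈⟨ sum-cong-≋ (λ i → sym (*-distribʳ-sum (x i) (λ l → a l * n l i))) ⟩
    sum (λ i → sum (λ l → a l * n l i) * x i)   ≈⟨ sum-zero _ (λ i → trans (*-congʳ (dep i)) (zeroˡ (x i))) ⟩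
    0#                                          ∎

  -- The origin forces the offset to be zero, and each basis vector then reads off one coefficient.
  -- This gives both the spanning property and the final contradictions with `nonzero`.
  affine-vanishing : ∀ {D} (n : Fin D → Carrier) o →
    (∀ p → ⟨ n ∙ simplex p ⟩ ≈ o) → ∀ c → n c ≈ 0#
  affine-vanishing n o on c = begin
    n c                      ≈⟨ ∙-vertex n c ⟨
    ⟨ n ∙ simplex (suc c) ⟩  ≈⟨ on (suc c) ⟩
    o                        ≈⟨ on zero ⟨
    ⟨ n ∙ simplex zero ⟩     ≈⟨ ∙-origin n ⟩
    0#                       ∎

  apex : ∀ {D s} → Carrier → (Fin D → Carrier) → (Fin s → Fin D → Carrier) → Fin D → Carrier
  apex t x y i = t * x i + - sum (λ v → y v i)

  -- Since `n` kills `x`, the multiple of `x` is invisible to it and the rest of the apex cancels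
  -- the sum of the `y v`. The coefficient `t` thus stays free for telling apexes apart.
  ∙-apex : ∀ {D s} (n : Fin D → Carrier) t x (y : Fin s → Fin D → Carrier) →
    ⟨ n ∙ x ⟩ ≈ 0# → ⟨ n ∙ apex t x y ⟩ + sum (λ v → ⟨ n ∙ y v ⟩) ≈ 0#
  ∙-apex {D} {s} n t x y nx≈0 = begin
    ⟨ n ∙ apex t x y ⟩ + Σy
      ≈⟨ +-congʳ (∙-+ n (λ i → t * x i) (λ i → - sum (λ v → y v i))) ⟩
    ⟨ n ∙ (λ i → t * x i) ⟩ + ⟨ n ∙ (λ i → - sum (λ v → y v i)) ⟩ + Σy
      ≈⟨ +-congʳ (+-cong (∙-scale n t x) (∙-neg n (λ i → sum (λ v → y v i)))) ⟩
    t * ⟨ n ∙ x ⟩ + - ⟨ n ∙ (λ i → sum (λ v → y v i)) ⟩ + Σy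
      ≈⟨ +-congʳ (+-cong (trans (*-congˡ nx≈0) (zeroʳ t)) (-‿cong (∙-sum n y))) ⟩
    0# + - Σy + Σy
      ≈⟨ +-congʳ (+-identityˡ (- Σy)) ⟩
    - Σy + Σy
      ≈⟨ -‿inverseˡ Σy ⟩
    0# ∎
    where
    Σy : Carrier
    Σy = sum (λ v → ⟨ n ∙ y v ⟩)

  apex-coordinate : ∀ {D s} t (x : Fin D → Carrier) (y : Fin s → Fin D → Carrier) i →
    x i ≈ 1# → (∀ v → y v i ≈ 0#) → apex t x y i ≈ t
  apex-coordinate t x y i xi≈1 y≈0 = begin
    t * x i + - sum (λ v → y v i)  ≈⟨ +-cong (*-congˡ xi≈1) (-‿cong (sum-zero _ y≈0)) ⟩
    t * 1# + - 0#                  ≈⟨ +-cong (*-identityʳ t) -0#≈0# ⟩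
    t + 0#                         ≈⟨ +-identityʳ t ⟩
    t                              ∎

  -- The summand is the real part of `a + ib` times the conjugate of `x + iy`, in the form to which
  -- `_*ᶜ_` and `conj` unfold; `im-∙` treats the imaginary part.
  re-∙ : ∀ {D} (a b x y : Fin D → Carrier) → (∀ i → y i ≈ 0#) →
    sum (λ i → a i * x i + - (b i * - y i)) ≈ ⟨ a ∙ x ⟩
  re-∙ a b x y y≈0 = sum-cong-≋ λ i → begin
    a i * x i + - (b i * - y i)  ≈⟨ +-congˡ (-‿cong (*-congˡ (trans (-‿cong (y≈0 i)) -0#≈0#))) ⟩
    a i * x i + - (b i * 0#)     ≈⟨ +-congˡ (trans (-‿cong (zeroʳ (b i))) -0#≈0#) ⟩
    a i * x i + 0#               ≈⟨ +-identityʳ _ ⟩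
    a i * x i                    ∎

  im-∙ : ∀ {D} (a b x y : Fin D → Carrier) →
    sum (λ i → a i * - y i + b i * x i) ≈ - ⟨ a ∙ y ⟩ + ⟨ b ∙ x ⟩
  im-∙ a b x y = trans (∑-distrib-+ (λ i → a i * - y i) (λ i → b i * x i))
                       (+-congʳ (∙-neg a y))

  im-∙-real : ∀ {D} (a b x y : Fin D → Carrier) → (∀ i → y i ≈ 0#) →
    sum (λ i → a i * - y i + b i * x i) ≈ ⟨ b ∙ x ⟩
  im-∙-real a b x y y≈0 = begin
    sum (λ i → a i * - y i + b i * x i)  ≈⟨ im-∙ a b x y ⟩
    - ⟨ a ∙ y ⟩ + ⟨ b ∙ x ⟩              ≈⟨ +-congʳ (trans (-‿cong (∙-zero a y y≈0)) -0#≈0#) ⟩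
    0# + ⟨ b ∙ x ⟩                       ≈⟨ +-identityˡ _ ⟩
    ⟨ b ∙ x ⟩                            ∎

  -- With real coefficients, the imaginary part of the functional at `x + iy` is minus the value at
  -- `y`; hence a real value at `x + iy` means zero at `y`.
  im-∙-vanishing : ∀ {D} (a b x y : Fin D → Carrier) → (∀ i → b i ≈ 0#) →
    sum (λ i → a i * - y i + b i * x i) ≈ 0# → ⟨ a ∙ y ⟩ ≈ 0#
  im-∙-vanishing a b x y b≈0 im≈0 = begin
    ⟨ a ∙ y ⟩                                   ≈⟨ -‿involutive _ ⟨
    - - ⟨ a ∙ y ⟩                               ≈⟨ -‿cong (+-identityʳ _) ⟨
    - (- ⟨ a ∙ y ⟩ + 0#)                        ≈⟨ -‿cong (+-congˡ (sum-zero _ λ i →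
                                                    trans (*-congʳ (b≈0 i)) (zeroˡ (x i)))) ⟨
    - (- ⟨ a ∙ y ⟩ + ⟨ b ∙ x ⟩)                 ≈⟨ -‿cong (im-∙ a b x y) ⟨
    - sum (λ i → a i * - y i + b i * x i)       ≈⟨ -‿cong im≈0 ⟩
    - 0#                                        ≈⟨ -0#≈0# ⟩
    0#                                          ∎

  -- Without its `l`-th term the relation only involves the remaining vectors, which are
  -- independent. Hence a nontrivial relation among the normals of a conical fan has no zero
  -- coefficient.
  relation-vanishes : ∀ {r D} (n : Fin (suc r) → Fin D → Carrier) l →
    ((b : Fin r → Carrier) → (∀ i → sum (λ k → b k * n (punchIn l k) i) ≈ 0#) → ∀ k → b k ≈ 0#) →
    (a : Fin (suc r) → Carrier) → (∀ i → sum (λ k → a k * n k i) ≈ 0#) →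
    a l ≈ 0# → ∀ k → a k ≈ 0#
  relation-vanishes n l indep a dep al≈0 k with l ≟ k
  ... | yes ≡.refl = al≈0
  ... | no l≢k = ≡.subst (λ k → a k ≈ 0#) (punchIn-punchOut l≢k)
    (indep (a ∘ punchIn l) rest (punchOut l≢k))
    where
    rest : ∀ i → sum (λ k → a (punchIn l k) * n (punchIn l k) i) ≈ 0#
    rest i = begin
      sum (λ k → a (punchIn l k) * n (punchIn l k) i)
        ≈⟨ +-identityˡ _ ⟨
      0# + sum (λ k → a (punchIn l k) * n (punchIn l k) i)
        ≈⟨ +-congʳ (trans (*-congʳ al≈0) (zeroˡ (n l i))) ⟨
      a l * n l i + sum (λ k → a (punchIn l k) * n (punchIn l k) i)
        ≈⟨ sum-remove {i = l} (λ k → a k * n k i) ⟨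
      sum (λ k → a k * n k i)
        ≈⟨ dep i ⟩
      0# ∎

  -- Vanishing around the cycle of half-flats

  module ConicalVanishing
    (0≤_ : Pred Carrier 0ℓ)
    (≈0⇒0≤ : ∀ x → x ≈ 0# → 0≤ x)
    (0≤-+ : ∀ x y → 0≤ x → 0≤ y → 0≤ (x + y))
    (0≤-+-cancelˡ : ∀ x y → 0≤ x → 0≤ y → x + y ≈ 0# → x ≈ 0#)
    (*-cancel-0 : ∀ x y → ¬ (x ≈ 0#) → x * y ≈ 0# → y ≈ 0#)
    where

    0≤-sum : ∀ {s} (f : Fin s → Carrier) → (∀ u → 0≤ f u) → 0≤ sum f
    0≤-sum {zero}  f f≥0 = ≈0⇒0≤ 0# refl
    0≤-sum {suc s} f f≥0 = 0≤-+ (f zero) (sum (f ∘ suc)) (f≥0 zero) (0≤-sum (f ∘ suc) (f≥0 ∘ suc))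

    0≤-sum-zero : ∀ {s} (f : Fin s → Carrier) → (∀ u → 0≤ f u) → sum f ≈ 0# → ∀ u → f u ≈ 0#
    0≤-sum-zero {suc s} f f≥0 Σf≈0 u = 0≤-+-cancelˡ (f u) (sum (f ∘ punchIn u)) (f≥0 u)
      (0≤-sum (f ∘ punchIn u) (f≥0 ∘ punchIn u)) (trans (sym (sum-remove {i = u} f)) Σf≈0)

    -- Here `h l u` is the value of the `l`-th functional at the `u`-th entry of a cluster, and
    -- `j u` is the half-flat assigned to it. Membership in that half-flat supplies `off` and `pos`,
    -- the linear relation among the normals `dep`, and the choice of the apex `bal`.
    all-vanish : ∀ {r s} → s ℕ.< r → (a : Fin r → Carrier) → (∀ l → ¬ (a l ≈ 0#)) →
      (j : Fin s → Fin r) (h : Fin r → Fin s → Carrier) →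
      (∀ u → sum (λ l → a l * h l u) ≈ 0#) →
      (∀ u l → l ≢ cyclicPred (j u) → l ≢ j u → h l u ≈ 0#) →
      (∀ u → 0≤ h (j u) u) →
      (∀ l → sum (h l) ≈ 0#) →
      ∀ i u → h (cyclicPred i) u ≈ 0#
    all-vanish {r} {s} s<r a a≉0 j h dep off pos bal i = vanish i (cyclic-induction P step i₀ P-i₀ i)
      where
      P : Pred (Fin r) 0ℓ
      P i = ∀ u → j u ≡ i → h (cyclicPred i) u ≈ 0#

      i₀ = proj₁ (missed-value s<r j)

      P-i₀ : P i₀
      -- The induction starts vacuously, because no entry of the cluster is assigned to `i₀`.
      P-i₀ u ju≡i₀ = contradiction ju≡i₀ (proj₂ (missed-value s<r j) u)

      vanish : ∀ i → P i → ∀ u → h (cyclicPred i) u ≈ 0#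
      vanish i Pi = 0≤-sum-zero (h (cyclicPred i)) nonneg (bal (cyclicPred i))
        where
        nonneg : ∀ u → 0≤ h (cyclicPred i) u
        nonneg u with j u ≟ cyclicPred i | j u ≟ i
        ... | yes eq | _      = ≡.subst (λ l → 0≤ h l u) eq (pos u)
        ... | no _   | yes eq = ≈0⇒0≤ _ (Pi u eq)
        ... | no ≢p  | no ≢i  = ≈0⇒0≤ _ (off u (cyclicPred i)
                                  (λ eq → ≢i (≡.sym (cyclicPred-injective eq))) (≢p ∘ ≡.sym))

      step : ∀ i → P i → P (cyclicPred i)
      -- On the half-flat of index i - 1 only the functionals i - 1 and i - 2 can be nonzero. The
      -- former vanishes by `vanish`, so the relation is reduced to a single term, with nonzero
      -- coefficient.
      step i Pi u ju≡i′ = *-cancel-0 (a i″) (h i″ u) (a≉0 i″)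
        (trans (sym (sum-single i″ (λ l → a l * h l u) others)) (dep u))
        where
        i″ = cyclicPred (cyclicPred i)
        others : ∀ l → l ≢ i″ → a l * h l u ≈ 0#
        others l l≢ with l ≟ cyclicPred i
        ... | yes ≡.refl = trans (*-congˡ (vanish i Pi u)) (zeroʳ _)
        ... | no l≢i′    = trans (*-congˡ (off u l
          (λ eq → l≢ (≡.trans eq (≡.cong cyclicPred ju≡i′)))
          (λ eq → l≢i′ (≡.trans eq ju≡i′)))) (zeroʳ _)

-- Cauchy reals

open import Relation.Binary.PropositionalEquality
  using (refl; sym; trans; cong; cong₂; subst; subst₂; module ≡-Reasoning)
open CauchySequences using (½-pos; ½+½; eventually-bounded; small; *-bound)

Eventually : (ℕ → Set) → Set
Eventually P = ∃[ N ] (∀ n → N ℕ.≤ n → P n)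

eventually-map₂ : ∀ {P Q R : ℕ → Set} → (∀ n → P n → Q n → R n) →
  Eventually P → Eventually Q → Eventually R
eventually-map₂ h (M , p) (N , q) = M ℕ.⊔ N , λ n n≥ →
  h n (p n (ℕ.m⊔n≤o⇒m≤o M N n≥)) (q n (ℕ.m⊔n≤o⇒n≤o M N n≥))

eventually-map : ∀ {P Q : ℕ → Set} → (∀ n → P n → Q n) →
  Eventually P → Eventually Q
eventually-map h (N , p) = N , λ n n≥ → h n (p n n≥)

Null : (ℕ → ℚ) → Set
Null f = ∀ ε → 0ℚ ℚ.< ε → Eventually (λ n → ℚ.∣ f n ∣ ℚ.< ε)

null-cong : ∀ {f g} → (∀ n → f n ≡ g n) → Null f → Null g
null-cong f≗g F ε 0<ε = eventually-map
  (λ n → subst (λ q → ℚ.∣ q ∣ ℚ.< ε) (f≗g n)) (F ε 0<ε)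

null-0 : Null (λ _ → 0ℚ)
null-0 ε 0<ε = 0 , λ _ _ → 0<ε

null-+ : ∀ {f g} → Null f → Null g → Null (λ n → f n ℚ.+ g n)
null-+ {f} {g} F G ε 0<ε = eventually-map₂
  (λ n p q → ℚ.≤-<-trans (ℚ.∣p+q∣≤∣p∣+∣q∣ (f n) (g n))
    (subst (_ ℚ.<_) (½+½ ε) (ℚ.+-mono-< p q)))
  (F (½ ℚ.* ε) (½-pos 0<ε)) (G (½ ℚ.* ε) (½-pos 0<ε))

null-neg : ∀ {f} → Null f → Null (λ n → ℚ.- f n)
null-neg {f} F ε 0<ε = eventually-map
  (λ n → subst (ℚ._< ε) (sym (ℚ.∣-p∣≡∣p∣ (f n)))) (F ε 0<ε)

null-* : ∀ {f g} → Cauchy f → Null g → Null (λ n → f n ℚ.* g n)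
null-* {f} {g} F G ε 0<ε =
  let K , K>0 , B = eventually-bounded F
      δ , 0<δ , Kδ = small K {{K>0}} 0<ε
  in eventually-map₂
       (λ n b d → ℚ.<-trans
         (subst (_ ℚ.<_) Kδ (*-bound K δ (f n) (g n) K>0 b d)) ½ε<ε)
       B (G δ 0<δ)
  where
  ½ε<ε : ½ ℚ.* ε ℚ.< ε
  ½ε<ε = subst₂ ℚ._<_ (ℚ.+-identityʳ _) (½+½ ε) (ℚ.+-monoʳ-< (½ ℚ.* ε) (½-pos 0<ε))

pointwise : ∀ {x y} → (∀ n → seq x n ≡ seq y n) → x ≈ʳ y
pointwise {x} {y} x≗y = null-cong
  (λ n → sym (trans (cong (ℚ._- seq y n) (x≗y n)) (ℚ.+-inverseʳ (seq y n)))) null-0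

≈0⇒null : ∀ {x} → x ≈ʳ 0ʳ → Null (seq x)
≈0⇒null {x} = null-cong (λ n → ℚ.+-identityʳ (seq x n))

null⇒≈0 : ∀ {x} → Null (seq x) → x ≈ʳ 0ʳ
null⇒≈0 {x} = null-cong (λ n → sym (ℚ.+-identityʳ (seq x n)))

private
  module Pointwise where
    open ℚ.+-*-Solver

    swap : ∀ a b → ℚ.- (a ℚ.- b) ≡ b ℚ.- a
    swap = solve 2 (λ a b → :- (a :- b) := b :- a) refl

    telescope : ∀ a b c → (a ℚ.- b) ℚ.+ (b ℚ.- c) ≡ a ℚ.- c
    telescope = solve 3 (λ a b c → (a :- b) :+ (b :- c) := a :- c) refl

    +-diff : ∀ a b c d →
      (a ℚ.- b) ℚ.+ (c ℚ.- d) ≡ (a ℚ.+ c) ℚ.- (b ℚ.+ d)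
    +-diff = solve 4 (λ a b c d →
      (a :- b) :+ (c :- d) := (a :+ c) :- (b :+ d)) refl

    *-diff : ∀ a b c d →
      c ℚ.* (a ℚ.- b) ℚ.+ b ℚ.* (c ℚ.- d) ≡ a ℚ.* c ℚ.- b ℚ.* d
    *-diff = solve 4 (λ a b c d →
      c :* (a :- b) :+ b :* (c :- d) := a :* c :- b :* d) refl

    neg-diff : ∀ a b → ℚ.- (a ℚ.- b) ≡ (ℚ.- a) ℚ.- (ℚ.- b)
    neg-diff = solve 2 (λ a b → :- (a :- b) := (:- a) :- (:- b)) refl

≈ʳ-isEquivalence : IsEquivalence _≈ʳ_
≈ʳ-isEquivalence = record
  { refl  = λ {x} → pointwise {x} {x} (λ _ → refl)
  ; sym   = λ {x} {y} x≈y →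
      null-cong (λ n → Pointwise.swap (seq x n) (seq y n)) (null-neg x≈y)
  ; trans = λ {x} {y} {z} x≈y y≈z →
      null-cong (λ n → Pointwise.telescope (seq x n) (seq y n) (seq z n)) (null-+ x≈y y≈z)
  }

+ʳ-cong : Congruent₂ _≈ʳ_ _+ʳ_
+ʳ-cong {x} {y} {u} {v} x≈y u≈v = null-cong
  (λ n → Pointwise.+-diff (seq x n) (seq y n) (seq u n) (seq v n)) (null-+ x≈y u≈v)

*ʳ-cong : Congruent₂ _≈ʳ_ _*ʳ_
*ʳ-cong {x} {y} {u} {v} x≈y u≈v = null-cong
  (λ n → Pointwise.*-diff (seq x n) (seq y n) (seq u n) (seq v n))
  (null-+ {λ n → seq u n ℚ.* (seq x n ℚ.- seq y n)} {λ n → seq y n ℚ.* (seq u n ℚ.- seq v n)}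
    (null-* {seq u} (cauchy u) x≈y) (null-* {seq y} (cauchy y) u≈v))

-ʳ-cong : Congruent₁ _≈ʳ_ -ʳ_
-ʳ-cong {x} {y} x≈y =
  null-cong (λ n → Pointwise.neg-diff (seq x n) (seq y n)) (null-neg x≈y)

ℝ-commutativeRing : CommutativeRing 0ℓ 0ℓ
ℝ-commutativeRing = record
  { Carrier = ℝ ; _≈_ = _≈ʳ_ ; _+_ = _+ʳ_ ; _*_ = _*ʳ_ ; -_ = -ʳ_
  ; 0# = 0ʳ ; 1# = 1ʳ
  ; isCommutativeRing = record
    { isRing = record
      { +-isAbelianGroup = record
        { isGroup = record
          { isMonoid = record
            { isSemigroup = record
              { isMagma = record
                { isEquivalence = ≈ʳ-isEquivalence
                ; ∙-cong = λ {x} {y} {u} {v} → +ʳ-cong {x} {y} {u} {v} }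
              ; assoc = λ x y z → pointwise {(x +ʳ y) +ʳ z} {x +ʳ (y +ʳ z)}
                  λ n → ℚ.+-assoc (seq x n) (seq y n) (seq z n) }
            ; identity =
                (λ x → pointwise {0ʳ +ʳ x} {x} λ n → ℚ.+-identityˡ (seq x n)) ,
                (λ x → pointwise {x +ʳ 0ʳ} {x} λ n → ℚ.+-identityʳ (seq x n)) }
          ; inverse =
              (λ x → pointwise { -ʳ x +ʳ x} {0ʳ} λ n → ℚ.+-inverseˡ (seq x n)) ,
              (λ x → pointwise {x +ʳ -ʳ x} {0ʳ} λ n → ℚ.+-inverseʳ (seq x n))
          ; ⁻¹-cong = λ {x} {y} → -ʳ-cong {x} {y} }
        ; comm = λ x y → pointwise {x +ʳ y} {y +ʳ x}
            λ n → ℚ.+-comm (seq x n) (seq y n) }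
      ; *-cong = λ {x} {y} {u} {v} → *ʳ-cong {x} {y} {u} {v}
      ; *-assoc = λ x y z → pointwise {(x *ʳ y) *ʳ z} {x *ʳ (y *ʳ z)}
          λ n → ℚ.*-assoc (seq x n) (seq y n) (seq z n)
      ; *-identity =
          (λ x → pointwise {1ʳ *ʳ x} {x} λ n → ℚ.*-identityˡ (seq x n)) ,
          (λ x → pointwise {x *ʳ 1ʳ} {x} λ n → ℚ.*-identityʳ (seq x n))
      ; distrib =
          (λ x y z → pointwise {x *ʳ (y +ʳ z)} {x *ʳ y +ʳ x *ʳ z}
            λ n → ℚ.*-distribˡ-+ (seq x n) (seq y n) (seq z n)) ,
          (λ x y z → pointwise {(y +ʳ z) *ʳ x} {y *ʳ x +ʳ z *ʳ x}
            λ n → ℚ.*-distribʳ-+ (seq x n) (seq y n) (seq z n)) }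
    ; *-comm = λ x y → pointwise {x *ʳ y} {y *ʳ x}
        λ n → ℚ.*-comm (seq x n) (seq y n) } }

-- Apartness, stability and order of the reals

∣p∣≤∣p-q∣+∣q∣ : ∀ p q → ℚ.∣ p ∣ ℚ.≤ ℚ.∣ p ℚ.- q ∣ ℚ.+ ℚ.∣ q ∣
∣p∣≤∣p-q∣+∣q∣ p q = subst (λ x → ℚ.∣ x ∣ ℚ.≤ ℚ.∣ p ℚ.- q ∣ ℚ.+ ℚ.∣ q ∣) (cancel p q)
  (ℚ.∣p+q∣≤∣p∣+∣q∣ (p ℚ.- q) q)
  where
  cancel : ∀ p q → (p ℚ.- q) ℚ.+ q ≡ p
  cancel = solve 2 (λ p q → (p :- q) :+ q := p) refl where open ℚ.+-*-Solver

-- From some `N` on the terms differ by less than ε/4, so comparing the one rational `∣ f N ∣` with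
-- ε/2 decides between staying below ε and staying at or above ε/4.
null-or-apart : ∀ {f} → Cauchy f → ∀ {ε} → 0ℚ ℚ.< ε →
  Eventually (λ n → ℚ.∣ f n ∣ ℚ.< ε) ⊎
  (∃[ δ ] (0ℚ ℚ.< δ × Eventually (λ n → δ ℚ.≤ ℚ.∣ f n ∣)))
null-or-apart {f} F {ε} 0<ε = decide (F δ 0<δ)
  where
  open ℚ.≤-Reasoning
  δ : ℚ
  δ = ½ ℚ.* (½ ℚ.* ε)
  0<δ : 0ℚ ℚ.< δ
  0<δ = ½-pos (½-pos 0<ε)
  δ<½ε : δ ℚ.< ½ ℚ.* ε
  δ<½ε = subst₂ ℚ._<_ (ℚ.+-identityʳ δ) (½+½ (½ ℚ.* ε)) (ℚ.+-monoʳ-< δ 0<δ)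
  decide : ∃[ N ] (∀ m n → N ℕ.≤ m → N ℕ.≤ n → ℚ.∣ f m ℚ.- f n ∣ ℚ.< δ) → _
  decide (N , P) with ℚ.∣ f N ∣ ℚ.<? ½ ℚ.* ε
  ... | yes fN< = inj₁ (N , λ n n≥ → begin-strict
    ℚ.∣ f n ∣                        ≤⟨ ∣p∣≤∣p-q∣+∣q∣ (f n) (f N) ⟩
    ℚ.∣ f n ℚ.- f N ∣ ℚ.+ ℚ.∣ f N ∣  <⟨ ℚ.+-mono-< (ℚ.<-trans (P n N n≥ ℕ.≤-refl) δ<½ε) fN< ⟩
    ½ ℚ.* ε ℚ.+ ½ ℚ.* ε              ≡⟨ ½+½ ε ⟩
    ε                                ∎)
  ... | no fN≮ = inj₂ (δ , 0<δ , N , λ n n≥ → ℚ.≮⇒≥ λ fn<δ → fN≮ (begin-strict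
    ℚ.∣ f N ∣                        ≤⟨ ∣p∣≤∣p-q∣+∣q∣ (f N) (f n) ⟩
    ℚ.∣ f N ℚ.- f n ∣ ℚ.+ ℚ.∣ f n ∣  <⟨ ℚ.+-mono-< (P N n ℕ.≤-refl n≥) fn<δ ⟩
    δ ℚ.+ δ                          ≡⟨ ½+½ (½ ℚ.* ε) ⟩
    ½ ℚ.* ε                          ∎))

apart⇒¬null : ∀ {f δ} → 0ℚ ℚ.< δ → Eventually (λ n → δ ℚ.≤ ℚ.∣ f n ∣) → ¬ Null f
apart⇒¬null {f} {δ} 0<δ far F = let N , p = both ; near , far′ = p N ℕ.≤-refl in
  ℚ.<-irrefl refl (ℚ.<-≤-trans near far′)
  where
  both : Eventually (λ n → ℚ.∣ f n ∣ ℚ.< δ × δ ℚ.≤ ℚ.∣ f n ∣)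
  both = eventually-map₂ (λ _ → _,_) (F δ 0<δ) far

-- For each ε the alternative of being apart is refuted by the double negation. Equations that hold
-- in the center up to double negation thereby become usable.
≈ʳ-stable : ∀ {x y} → ¬ ¬ (x ≈ʳ y) → x ≈ʳ y
≈ʳ-stable {x} {y} ¬¬x≈y ε 0<ε with null-or-apart (cauchy (x +ʳ -ʳ y)) 0<ε
... | inj₁ near = near
... | inj₂ (δ , 0<δ , far) = contradiction (apart⇒¬null 0<δ far) ¬¬x≈y

-- If `y` were eventually at least δ in absolute value, then δ times the absolute value of `x` would
-- be bounded by that of the null product, and `x` would be zero.
*ʳ-cancel-0 : ∀ x y → ¬ (x ≈ʳ 0ʳ) → x *ʳ y ≈ʳ 0ʳ → y ≈ʳ 0ʳ
*ʳ-cancel-0 x y x≉0 xy≈0 = null⇒≈0 {y} y-null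
  where
  y-null : Null (seq y)
  y-null ε 0<ε with null-or-apart (cauchy y) 0<ε
  ... | inj₁ near = near
  ... | inj₂ (δ , 0<δ , far) = contradiction (null⇒≈0 {x} x-null) x≉0
    where
    instance
      δ-positive : ℚ.Positive δ
      δ-positive = ℚ.positive 0<δ
      δ-nonNegative : ℚ.NonNegative δ
      δ-nonNegative = ℚ.pos⇒nonNeg δ
    x-null : Null (seq x)
    x-null η 0<η = eventually-map₂
      (λ n d xy → ℚ.*-cancelʳ-<-nonNeg δ (ℚ.≤-<-trans
        (ℚ.*-monoˡ-≤-nonNeg ℚ.∣ seq x n ∣ {{ℚ.∣-∣-nonNeg (seq x n)}} d)
        (subst (ℚ._< η ℚ.* δ) (ℚ.∣p*q∣≡∣p∣*∣q∣ (seq x n) (seq y n)) xy)))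
      far
      (≈0⇒null {x *ʳ y} xy≈0 (η ℚ.* δ)
        (subst (ℚ._< η ℚ.* δ) (ℚ.*-zeroˡ δ) (ℚ.*-monoˡ-<-pos δ 0<η)))

p≤∣p∣ : ∀ p → p ℚ.≤ ℚ.∣ p ∣
p≤∣p∣ p with ℚ.≤-total 0ℚ p
... | inj₁ 0≤p = ℚ.≤-reflexive (sym (ℚ.0≤p⇒∣p∣≡p 0≤p))
... | inj₂ p≤0 = ℚ.≤-trans p≤0 (ℚ.0≤∣p∣ p)

≈0⇒0≤ : ∀ x → x ≈ʳ 0ʳ → 0ʳ ≤ʳ x
≈0⇒0≤ x x≈0 ε 0<ε = eventually-map
  (λ n p → ∣q∣<ε⇒0<q+ε (seq x n) ε p) (≈0⇒null {x} x≈0 ε 0<ε)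
  where
  ∣q∣<ε⇒0<q+ε : ∀ q ε → ℚ.∣ q ∣ ℚ.< ε → 0ℚ ℚ.< q ℚ.+ ε
  ∣q∣<ε⇒0<q+ε q ε q< = subst (ℚ._< q ℚ.+ ε) (ℚ.+-inverseʳ q) (ℚ.+-monoʳ-< q
    (ℚ.≤-<-trans (subst (ℚ.- q ℚ.≤_) (ℚ.∣-p∣≡∣p∣ q) (p≤∣p∣ (ℚ.- q))) q<))

0≤-+ : ∀ x y → 0ʳ ≤ʳ x → 0ʳ ≤ʳ y → 0ʳ ≤ʳ x +ʳ y
0≤-+ x y 0≤x 0≤y ε 0<ε = eventually-map₂
  (λ n p q → subst (0ℚ ℚ.<_) (trans (regroup (seq x n) (seq y n) (½ ℚ.* ε))
     (cong ((seq x n ℚ.+ seq y n) ℚ.+_) (½+½ ε))) (ℚ.+-mono-< p q))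
  (0≤x (½ ℚ.* ε) (½-pos 0<ε)) (0≤y (½ ℚ.* ε) (½-pos 0<ε))
  where
  regroup : ∀ a b e → (a ℚ.+ e) ℚ.+ (b ℚ.+ e) ≡ (a ℚ.+ b) ℚ.+ (e ℚ.+ e)
  regroup = solve 3 (λ a b e → (a :+ e) :+ (b :+ e) := (a :+ b) :+ (e :+ e)) refl
    where open ℚ.+-*-Solver

0≤-shift : ∀ {x y} → x ≤ʳ y → x ≈ʳ 0ʳ → 0ʳ ≤ʳ y
0≤-shift {x} {y} x≤y x≈0 ε 0<ε = eventually-map₂
  (λ n p q → subst (0ℚ ℚ.<_) (trans (ℚ.+-assoc (seq y n) _ _) (cong (seq y n ℚ.+_) (½+½ ε)))
     (ℚ.<-trans p (ℚ.+-monoˡ-< (½ ℚ.* ε) q)))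
  (≈0⇒0≤ x x≈0 (½ ℚ.* ε) (½-pos 0<ε)) (x≤y (½ ℚ.* ε) (½-pos 0<ε))

-- A squeeze: `x` is eventually above -ε, and it is below ε because `x + y` is below ε/2 while `y`
-- is above -ε/2.
0≤-+-cancelˡ : ∀ x y → 0ʳ ≤ʳ x → 0ʳ ≤ʳ y → x +ʳ y ≈ʳ 0ʳ → x ≈ʳ 0ʳ
0≤-+-cancelˡ x y 0≤x 0≤y x+y≈0 = null⇒≈0 {x} λ ε 0<ε → eventually-map₂
  (λ n p (q , s) → ∣q∣< (seq x n) ε p
    (subst₂ ℚ._<_ (ℚ.+-identityʳ (seq x n))
      (½+½ ε)
      (ℚ.<-trans (ℚ.+-monoʳ-< (seq x n) q)
        (subst (ℚ._< ½ ℚ.* ε ℚ.+ ½ ℚ.* ε) (ℚ.+-assoc (seq x n) (seq y n) (½ ℚ.* ε))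
          (ℚ.+-monoˡ-< (½ ℚ.* ε) (ℚ.≤-<-trans (p≤∣p∣ _) s))))))
  (0≤x ε 0<ε)
  (eventually-map₂ (λ _ → _,_) (0≤y (½ ℚ.* ε) (½-pos 0<ε))
    (≈0⇒null {x +ʳ y} x+y≈0 (½ ℚ.* ε) (½-pos 0<ε)))
  where
  ∣q∣< : ∀ q ε → 0ℚ ℚ.< q ℚ.+ ε → q ℚ.< ε → ℚ.∣ q ∣ ℚ.< ε
  ∣q∣< q ε 0<q+ε q<ε with ℚ.∣p∣≡p∨∣p∣≡-p q
  ... | inj₁ eq = subst (ℚ._< ε) (sym eq) q<ε
  ... | inj₂ eq = subst (ℚ._< ε) (sym eq)
    (subst₂ ℚ._<_ (ℚ.+-identityʳ (ℚ.- q)) (cancel q ε) (ℚ.+-monoʳ-< (ℚ.- q) 0<q+ε))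
    where
    cancel : ∀ q ε → ℚ.- q ℚ.+ (q ℚ.+ ε) ≡ ε
    cancel = solve 2 (λ q ε → :- q :+ (q :+ ε) := ε) refl where open ℚ.+-*-Solver

module ≈ʳ = CommutativeRing ℝ-commutativeRing
module ≈ʳ-Reasoning = SetoidReasoning ≈ʳ.setoid

open InnerProduct ℝ-commutativeRing
open ConicalVanishing (0ʳ ≤ʳ_) ≈0⇒0≤ 0≤-+ 0≤-+-cancelˡ *ʳ-cancel-0

-- Colorings whose small classes are forced into the center

open import Data.Nat using (_+_; _*_; _∸_; _≤_; _<_)

-- Dropping the first index moves the window down by one: `lo` decreases until it is zero, and from
-- then on only `s` shrinks, once for each index counted.
∣interval∣≤ : ∀ N lo s (f : Fin N → Bool) →
  (∀ p → f p ≡ true → lo ≤ toℕ p × toℕ p < lo + s) → ∣ tabulate f ∣ ≤ s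
∣interval∣≤ zero lo s f h = z≤n
∣interval∣≤ (suc N) lo s f h with f zero | h zero
∣interval∣≤ (suc N) (suc lo) s f h | true | h₀ = contradiction (proj₁ (h₀ refl)) λ ()
∣interval∣≤ (suc N) (suc lo) s f h | false | _ = ∣interval∣≤ N lo s (f ∘ suc)
  λ p eq → let l , u = h (suc p) eq in s≤s⁻¹ l , s≤s⁻¹ u
∣interval∣≤ (suc N) zero zero f h | true | h₀ = contradiction (proj₂ (h₀ refl)) λ ()
∣interval∣≤ (suc N) zero (suc s) f h | true | _ = s≤s (∣interval∣≤ N 0 s (f ∘ suc)
  λ p eq → z≤n , s≤s⁻¹ (proj₂ (h (suc p) eq)))
∣interval∣≤ (suc N) zero zero f h | false | _ = ∣interval∣≤ N 0 0 (f ∘ suc)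
  λ p eq → contradiction (proj₂ (h (suc p) eq)) λ ()
∣interval∣≤ (suc N) zero (suc s) f h | false | _ = ℕ.m≤n⇒m≤1+n (∣interval∣≤ N 0 s (f ∘ suc)
  λ p eq → z≤n , s≤s⁻¹ (proj₂ (h (suc p) eq)))

module _ {N : ℕ} (μ s : ℕ) .{{_ : ℕ.NonZero s}} where

  -- Consecutive intervals of `s` indices, where the minimum hands everything from `μ * s` on to the
  -- last color. All other classes thus have at most `s` elements.
  blocks : Fin N → Fin (suc μ)
  blocks p = fromℕ< (s≤s (ℕ.m⊓n≤n (toℕ p ℕ./ s) μ))

  toℕ-blocks : ∀ p → toℕ (blocks p) ≡ (toℕ p ℕ./ s) ℕ.⊓ μ
  toℕ-blocks p = toℕ-fromℕ< _

  blocks-isColoring : μ * s < N → IsColoring blocks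
  blocks-isColoring μs<N y = fromℕ< ys<N , λ { refl → toℕ-injective (begin
    toℕ (blocks (fromℕ< ys<N))         ≡⟨ toℕ-blocks _ ⟩
    (toℕ (fromℕ< ys<N) ℕ./ s) ℕ.⊓ μ    ≡⟨ cong (λ a → (a ℕ./ s) ℕ.⊓ μ) (toℕ-fromℕ< ys<N) ⟩
    (toℕ y * s ℕ./ s) ℕ.⊓ μ            ≡⟨ cong (ℕ._⊓ μ) (ℕ.m*n/n≡m (toℕ y) s) ⟩
    toℕ y ℕ.⊓ μ                        ≡⟨ ℕ.m≤n⇒m⊓n≡m y≤μ ⟩
    toℕ y                              ∎) }
    where
    open ≡-Reasoning
    y≤μ : toℕ y ≤ μ
    y≤μ = s≤s⁻¹ (toℕ<n y)
    ys<N : toℕ y * s < N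
    ys<N = ℕ.≤-<-trans (ℕ.*-monoˡ-≤ s y≤μ) μs<N

  ∣block∣≤ : ∀ p → toℕ p < μ * s → ∣ colorClass blocks (blocks p) ∣ ≤ s
  ∣block∣≤ p p<μs = ∣interval∣≤ N (toℕ p ℕ./ s * s) s _ same-block
    where
    p/s<μ : toℕ p ℕ./ s < μ
    p/s<μ = ℕ.m<n*o⇒m/o<n p<μs
    p/s⊓μ : toℕ (blocks p) ≡ toℕ p ℕ./ s
    p/s⊓μ = trans (toℕ-blocks p) (ℕ.m≤n⇒m⊓n≡m (ℕ.<⇒≤ p/s<μ))
    same-quotient : ∀ q → blocks q ≡ blocks p → toℕ q ℕ./ s ≡ toℕ p ℕ./ s
    same-quotient q eq with ℕ.≤-total (toℕ q ℕ./ s) μ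
    ... | inj₁ q/s≤μ = trans (sym (trans (toℕ-blocks q) (ℕ.m≤n⇒m⊓n≡m q/s≤μ)))
                             (trans (cong toℕ eq) p/s⊓μ)
    ... | inj₂ μ≤q/s = contradiction
      (trans (sym (trans (toℕ-blocks q) (ℕ.m≥n⇒m⊓n≡n μ≤q/s))) (trans (cong toℕ eq) p/s⊓μ))
      (ℕ.>⇒≢ p/s<μ)
    in-block : ∀ q → toℕ q ℕ./ s ≡ toℕ p ℕ./ s →
      toℕ p ℕ./ s * s ≤ toℕ q × toℕ q < toℕ p ℕ./ s * s + s
    in-block q eq rewrite sym eq = ℕ.m/n*n≤m (toℕ q) s , (begin-strict
      toℕ q                            ≡⟨ ℕ.m≡m%n+[m/n]*n (toℕ q) s ⟩
      toℕ q ℕ.% s + toℕ q ℕ./ s * s    <⟨ ℕ.+-monoˡ-< _ (ℕ.m%n<n (toℕ q) s) ⟩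
      s + toℕ q ℕ./ s * s              ≡⟨ ℕ.+-comm s _ ⟩
      toℕ q ℕ./ s * s + s              ∎)
      where open ℕ.≤-Reasoning
    same-block : ∀ q → does (blocks q ≟ blocks p) ≡ true →
      toℕ p ℕ./ s * s ≤ toℕ q × toℕ q < toℕ p ℕ./ s * s + s
    same-block q eq with blocks q ≟ blocks p
    ... | yes same = in-block q (same-quotient q same)

-- Off the center, the point lies in the interior of a half containing it, and the bound for its
-- singleton makes its color class at least as large as `r`. The conclusion is doubly negated since
-- membership in the center is not decided.
small-class⇒center : ∀ {E : Set} {r N m} (F : Fan E r) {X : Fin N → E} {c : Fin N → Fin m} →
  Equidistributes F X c → ∀ p → ∣ colorClass c (c p) ∣ < r → ¬ ¬ (X p ∈ Fan.center F)
small-class⇒center {r = r} F {X} {c} (cover , bound) p small ∉center =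
  let j , ∈half = cover p in
  ℕ.<⇒≱ small (begin
    r                          ≡⟨ ℕ.*-identityʳ r ⟨
    r * 1                      ≡⟨ cong (r *_) (∣⁅x⁆∣≡1 p) ⟨
    r * ∣ ⁅ p ⁆ ∣              ≤⟨ bound j (c p) ⁅ p ⁆ (λ q q∈ → case x∈⁅y⁆⇒x≡y p q∈ of
                                    λ { refl → (∈half , ∉center) , refl }) ⟩
    ∣ colorClass c (c p) ∣     ∎)
  where open ℕ.≤-Reasoning

-- Counting conditions

-- With `suc ρ` for r - 2. Passing to unnormalised rationals removes the reduction to lowest terms
-- built into `_/_`, so that cross-multiplication computes.
clear-denominators : ∀ ρ k ℓ → (+ 2 / 1) +ℚ (+ (k + 2) / suc ρ) <ℚ (+ ℓ / 1) →
  2 * suc ρ + (k + 2) < ℓ * suc ρ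
clear-denominators ρ k ℓ lt = ℤ.drop‿+<+ (subst₂ ℤ._<_ lhs rhs (ℚᵘ.drop-*<* unnormalised))
  where
  toℚᵘ-/ : ∀ n d → toℚᵘ (n / suc d) ℚᵘ.≃ mkℚᵘ n d
  toℚᵘ-/ n d = ℚ.toℚᵘ-fromℚᵘ (mkℚᵘ n d)
  unnormalised : mkℚᵘ (+ 2) 0 ℚᵘ.+ mkℚᵘ (+ (k + 2)) ρ ℚᵘ.< mkℚᵘ (+ ℓ) 0
  unnormalised = ℚᵘ.<-respʳ-≃ (toℚᵘ-/ (+ ℓ) 0) (ℚᵘ.<-respˡ-≃
    (ℚᵘ.≃-trans (ℚ.toℚᵘ-homo-+ (+ 2 / 1) (+ (k + 2) / suc ρ))
      (ℚᵘ.+-cong (toℚᵘ-/ (+ 2) 0) (toℚᵘ-/ (+ (k + 2)) ρ)))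
    (ℚ.toℚᵘ-mono-< lt))
  lhs : ((+ 2) ℤ.* + suc ρ ℤ.+ + (k + 2) ℤ.* + 1) ℤ.* + 1 ≡ + (2 * suc ρ + (k + 2))
  lhs = trans (ℤ.*-identityʳ _) (cong (λ x → + (2 * suc ρ) ℤ.+ x) (ℤ.*-identityʳ (+ (k + 2))))
  rhs : + ℓ ℤ.* + (1 * suc ρ) ≡ + (ℓ * suc ρ)
  rhs = trans (sym (ℤ.pos-* ℓ (1 * suc ρ))) (cong (λ x → + (ℓ * x)) (ℕ.*-identityˡ (suc ρ)))

∸-∸-shift : ∀ {n d D} → n ≡ d + (1 + D) → n ∸ d ∸ 1 ≡ D
∸-∸-shift {d = d} {D} refl = cong (_∸ 1) (ℕ.m+n∸m≡n d (1 + D))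

+-shift : ∀ {n d D} ℓ → n ≡ d + (1 + D) → n + ℓ ≡ suc D + (d + ℓ)
+-shift {d = d} {D} ℓ refl = solve 3 (λ d D ℓ → d :+ (con 1 :+ D) :+ ℓ := con 1 :+ D :+ (d :+ ℓ)) refl d D ℓ
  where open ℕ.+-*-Solver

-- The left side counts the simplex vertices beyond the small color classes, the right side the
-- places for them in `d + ℓ` clusters with r - 2 spokes each. The bound on ℓ is this comparison
-- with `d * suc ρ` taken off both sides.
spokes-suffice : ∀ ρ d k ℓ → 2 * suc ρ + (k + 2) < ℓ * suc ρ →
  suc (suc ρ * d + (2 * suc ρ + k + 2)) ≤ (d + ℓ) * suc ρ
spokes-suffice ρ d k ℓ lt = begin
  suc (suc ρ * d + (2 * suc ρ + k + 2))
    ≡⟨ solve 4 (λ ρ d x k → con 1 :+ ((con 1 :+ ρ) :* d :+ (x :+ k :+ con 2)) :=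
         d :* (con 1 :+ ρ) :+ (con 1 :+ (x :+ (k :+ con 2)))) refl ρ d (2 * suc ρ) k ⟩
  d * suc ρ + suc (2 * suc ρ + (k + 2))
    ≤⟨ ℕ.+-monoʳ-≤ (d * suc ρ) lt ⟩
  d * suc ρ + ℓ * suc ρ
    ≡⟨ ℕ.*-distribʳ-+ (suc ρ) d ℓ ⟨
  (d + ℓ) * suc ρ ∎
  where
  open ℕ.+-*-Solver
  open ℕ.≤-Reasoning

-- The real configuration

open ≈ʳ-Reasoning

-- Given directly in lowest terms, so that injectivity is read off the numerator.
ℕ→ℚ : ℕ → ℚ
ℕ→ℚ n = mkℚ (+ n) 0 (Coprime.sym (Coprime.1-coprimeTo n))

ℕ→ℚ-injective : ∀ {m n} → ℕ→ℚ m ≡ ℕ→ℚ n → m ≡ n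
ℕ→ℚ-injective eq = ℤ.+-injective (cong ℚ.↥_ eq)

ι-injective : ∀ {p q} → ι p ≈ʳ ι q → p ≡ q
ι-injective {p} {q} p≈q with 0ℚ ℚ.<? ℚ.∣ p ℚ.- q ∣
... | yes 0<∣p-q∣ = let N , near = p≈q _ 0<∣p-q∣ in
  contradiction (near N ℕ.≤-refl) (ℚ.<-irrefl refl)
... | no  0≮∣p-q∣ = GroupProperties.x∙y⁻¹≈ε⇒x≈y ℚ.+-0-group p q
  (ℚ.∣p∣≡0⇒p≡0 _ (ℚ.≤-antisym (ℚ.≮⇒≥ 0≮∣p-q∣) (ℚ.0≤∣p∣ _)))

ℕ→ℚ-apart : ∀ m n → m ≢ n → ¬ (ι (ℕ→ℚ m) ≈ʳ ι (ℕ→ℚ n))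
ℕ→ℚ-apart m n m≢n m≈n = m≢n (ℕ→ℚ-injective (ι-injective m≈n))

module _ {D e : ℕ} (b : Fin e → ℝ^ (suc D))
         (b-zero : ∀ s → b s zero ≈ʳ ι (ℕ→ℚ (2 + toℕ s))) where

  simplex-zero : (p : Fin (suc (suc D))) →
    Σ[ t ∈ ℕ ] (t < 2 × simplex p zero ≡ ι (ℕ→ℚ t))
  simplex-zero zero          = 0 , s≤s z≤n , refl
  simplex-zero (suc zero)    = 1 , s≤s (s≤s z≤n) , refl
  simplex-zero (suc (suc p)) = 0 , s≤s z≤n , refl

  simplex-injective : (p q : Fin (suc (suc D))) → simplex p ≋ʳ simplex q → p ≡ q
  simplex-injective zero    zero    _   = refl
  simplex-injective zero    (suc d) p≋q = contradiction
    (subst (0ʳ ≈ʳ_) (simplex-diag d) (p≋q d)) (ℕ→ℚ-apart 0 1 λ ())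
  simplex-injective (suc c) q       p≋q = decidable-stable (suc c ≟ q) λ c≢q → contradiction
    (subst₂ _≈ʳ_ (simplex-diag c) (simplex-off q c (c≢q ∘ sym)) (p≋q c)) (ℕ→ℚ-apart 1 0 λ ())

  simplex≉b : ∀ p s → ¬ (simplex p ≋ʳ b s)
  simplex≉b p s p≋b with simplex-zero p
  ... | t , t<2 , eq = ℕ→ℚ-apart t (2 + toℕ s) (λ { refl → ℕ.<⇒≱ t<2 (ℕ.m≤m+n 2 _) }) (begin
    ι (ℕ→ℚ t)                ≡⟨ eq ⟨
    simplex p zero           ≈⟨ p≋b zero ⟩
    b s zero                 ≈⟨ b-zero s ⟩
    ι (ℕ→ℚ (2 + toℕ s))      ∎)

  -- The first coordinate is 0 or 1 on the simplex and `2 + s` on the extra points, which separates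
  -- the latter from the simplex and from each other.
  simplex++-distinct : Distinctʳ (simplex ++ b)
  simplex++-distinct {p} {q} X≋ with splitAt (suc (suc D)) p in eqp | splitAt (suc (suc D)) q in eqq
  ... | inj₁ p′ | inj₁ q′ = trans (sym (splitAt⁻¹-↑ˡ eqp))
    (trans (cong (_↑ˡ e) (simplex-injective p′ q′ X≋)) (splitAt⁻¹-↑ˡ eqq))
  ... | inj₁ p′ | inj₂ s  = contradiction X≋ (simplex≉b p′ s)
  ... | inj₂ s  | inj₁ q′ = contradiction (λ i → ≈ʳ.sym {b s i} {simplex q′ i} (X≋ i)) (simplex≉b q′ s)
  ... | inj₂ s  | inj₂ s′ = trans (sym (splitAt⁻¹-↑ʳ eqp))
    (trans (cong (suc (suc D) ↑ʳ_) s≡s′) (splitAt⁻¹-↑ʳ eqq))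
    where
    s≡s′ : s ≡ s′
    s≡s′ = toℕ-injective (ℕ.+-cancelˡ-≡ 2 _ _ (ℕ→ℚ-injective
      (ι-injective {ℕ→ℚ (2 + toℕ s)} {ℕ→ℚ (2 + toℕ s′)} (begin
        ι (ℕ→ℚ (2 + toℕ s))   ≈⟨ b-zero s ⟨
        b s zero              ≈⟨ X≋ zero ⟩
        b s′ zero             ≈⟨ b-zero s′ ⟩
        ι (ℕ→ℚ (2 + toℕ s′))  ∎))))

simplex++-spanning : ∀ {D e} (b : Fin e → ℝ^ D) → AffinelySpanning (simplex ++ b)
simplex++-spanning {e = e} b (H , on) = nonzero (affine-vanishing normal offset
  (λ p → subst (_∈ points) (lookup-++ˡ simplex b p) (on (p ↑ˡ e))))
  where open RealHyperplane H

-- Out-of-range numbers give the origin, so that short clusters are padded with it.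
vertex : ∀ {n} → ℕ → Fin (suc n)
vertex {n} a with a ℕ.<? suc n
... | yes a<1+n = fromℕ< a<1+n
... | no _      = zero

vertex-toℕ : ∀ {n} (p : Fin (suc n)) → vertex (toℕ p) ≡ p
vertex-toℕ {n} p with toℕ p ℕ.<? suc n
... | yes p<1+n = fromℕ<-toℕ p p<1+n
... | no p≮1+n  = contradiction (toℕ<n p) p≮1+n

-- Keeps the first basis vector out of all spokes, so that the first coordinate of an apex is
-- exactly its marking coefficient.
vertex≢1 : ∀ {n a} → 2 ≤ a → vertex {suc n} a ≢ suc zero
vertex≢1 {n} {a} 2≤a eq with a ℕ.<? suc (suc n)
... | yes a< = ℕ.<⇒≢ 2≤a (sym (trans (sym (toℕ-fromℕ< a<)) (cong toℕ eq)))
... | no _   = contradiction eq λ ()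

vertex-split : ∀ {n} σ k → suc n ∸ σ ≤ k → (p : Fin (suc n)) →
  toℕ p < σ ⊎ (∃[ w ] vertex (σ + toℕ {k} w) ≡ p)
vertex-split σ k n∸σ≤k p with toℕ p ℕ.<? σ
... | yes p<σ = inj₁ p<σ
... | no p≮σ  = inj₂ (fromℕ< w<k ,
  trans (cong (λ w → vertex (σ + w)) (toℕ-fromℕ< w<k))
    (trans (cong vertex (ℕ.m+[n∸m]≡n (ℕ.≮⇒≥ p≮σ))) (vertex-toℕ p)))
  where
  w<k : toℕ p ∸ σ < k
  w<k = ℕ.<-≤-trans (ℕ.∸-monoˡ-< (toℕ<n p) (ℕ.≮⇒≥ p≮σ)) n∸σ≤k

module RealConstruction (ρ μ D e : ℕ) where

  -- With m = `2 + μ`, the number `σ` is the total size of the m - 1 color classes of r - 1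
  -- elements. They occupy the first indices, including the origin and the first basis vector.
  r N σ : ℕ
  r = 3 + ρ
  N = suc (suc D) + e
  σ = (1 + μ) * (2 + ρ)

  -- The vertices from `σ` on, cut into consecutive runs of length r - 2.
  spoke : Fin e → Fin (1 + ρ) → Fin (suc (suc D))
  spoke s v = vertex (σ + toℕ (combine s v))

  spoke-split : suc (suc D) ∸ σ ≤ e * (1 + ρ) →
    ∀ p → toℕ p < σ ⊎ (∃[ s ] ∃[ v ] spoke s v ≡ p)
  spoke-split W≤ p = map₂ (λ (w , eq) →
    proj₁ (remQuot {e} (1 + ρ) w) , proj₂ (remQuot {e} (1 + ρ) w) ,
    trans (cong (λ w → vertex (σ + toℕ w)) (combine-remQuot {e} (1 + ρ) w)) eq)
    (vertex-split σ (e * (1 + ρ)) W≤ p)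

  -- The coefficient 2 + s of the first basis vector, which lies in the center, makes
  -- the points distinct even if a cluster has no other point.
  apexes : Fin e → ℝ^ (suc D)
  apexes s = apex (ι (ℕ→ℚ (2 + toℕ s))) (simplex (suc zero)) (simplex ∘ spoke s)

  X : Fin N → ℝ^ (suc D)
  X = simplex ++ apexes

  color : Fin N → Fin (2 + μ)
  color = blocks (1 + μ) (2 + ρ)

  2≤σ : 2 ≤ σ
  2≤σ = ℕ.≤-trans (ℕ.m≤m+n 2 ρ) (ℕ.m≤m+n (2 + ρ) _)

  apexes-zero : ∀ s → apexes s zero ≈ʳ ι (ℕ→ℚ (2 + toℕ s))
  apexes-zero s = apex-coordinate (ι (ℕ→ℚ (2 + toℕ s))) (simplex (suc zero)) (simplex ∘ spoke s) zero
    (≈ʳ.refl {1ʳ})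
    (λ v → ≈ʳ.reflexive (simplex-off (spoke s v) zero
      (vertex≢1 (ℕ.≤-trans 2≤σ (ℕ.m≤m+n σ _)))))

  module _ (W≤ : suc (suc D) ∸ σ ≤ e * (1 + ρ))
           (F : ConicalArrangement r (suc D))
           (equi : Equidistributes (ConicalArrangement.fan F) X color) where

    open ConicalArrangement F using (H; independent; dependent; fan)

    normal : Fin r → ℝ^ (suc D)
    normal i = RealHyperplane.normal (H i)

    offset : Fin r → ℝ
    offset i = RealHyperplane.offset (H i)

    small⇒on : ∀ p → toℕ p < σ → ∀ i → ⟨ normal i ∙ simplex p ⟩ ≈ʳ offset i
    small⇒on p p<σ i = ≈ʳ-stable {⟨ normal i ∙ simplex p ⟩} {offset i} λ ¬on →
      small-class⇒center fan {X} {color} equi (p ↑ˡ e)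
        (s≤s (∣block∣≤ (1 + μ) (2 + ρ) (p ↑ˡ e) (subst (_< σ) (sym (toℕ-↑ˡ p e)) p<σ)))
        λ on → ¬on (subst (λ x → ⟨ normal i ∙ x ⟩ ≈ʳ offset i) (lookup-++ˡ simplex apexes p) (on i))

    offset≈0 : ∀ i → offset i ≈ʳ 0ʳ
    offset≈0 i = begin
      offset i                      ≈⟨ small⇒on zero (ℕ.≤-trans (s≤s z≤n) 2≤σ) i ⟨
      ⟨ normal i ∙ simplex zero ⟩   ≈⟨ ∙-origin (normal i) ⟩
      0ʳ                            ∎

    small⇒0 : ∀ p → toℕ p < σ → ∀ i → ⟨ normal i ∙ simplex p ⟩ ≈ʳ 0ʳ
    small⇒0 p p<σ i = begin
      ⟨ normal i ∙ simplex p ⟩   ≈⟨ small⇒on p p<σ i ⟩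
      offset i                   ≈⟨ offset≈0 i ⟩
      0ʳ                         ∎

    cluster : Fin e → Fin (2 + ρ) → Fin N
    cluster s = (suc (suc D) ↑ʳ s) ∷ (λ v → spoke s v ↑ˡ e)

    position : Fin N → Fin r
    position p = proj₁ (proj₁ equi p)

    balanced : ∀ s i → sumʳ (λ u → ⟨ normal i ∙ X (cluster s u) ⟩) ≈ʳ 0ʳ
    balanced s i = begin
      ⟨ normal i ∙ X (suc (suc D) ↑ʳ s) ⟩ +ʳ sumʳ (λ v → ⟨ normal i ∙ X (spoke s v ↑ˡ e) ⟩)
        ≡⟨ cong₂ _+ʳ_ (cong (⟨ normal i ∙_⟩) (lookup-++ʳ simplex apexes s))
             (sum-cong-≗ {1 + ρ} {λ v → ⟨ normal i ∙ X (spoke s v ↑ˡ e) ⟩}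
               (λ v → cong (⟨ normal i ∙_⟩) (lookup-++ˡ simplex apexes (spoke s v)))) ⟩
      ⟨ normal i ∙ apexes s ⟩ +ʳ sumʳ (λ v → ⟨ normal i ∙ simplex (spoke s v) ⟩)
        ≈⟨ ∙-apex (normal i) (ι (ℕ→ℚ (2 + toℕ s))) (simplex (suc zero)) (simplex ∘ spoke s)
             -- The first basis vector has index 1, which is below `σ`, so the functional kills the
             -- marking term of the apex.
             (small⇒0 (suc zero) 2≤σ i) ⟩
      0ʳ ∎

    module _ (a : Fin r → ℝ) (a≉0 : ∀ l → ¬ (a l ≈ʳ 0ʳ))
             (relation : ∀ i → sumʳ (λ l → a l *ʳ normal l i) ≈ʳ 0ʳ) where

      cluster-vanishes : ∀ s i u → ⟨ normal (cyclicPred i) ∙ X (cluster s u) ⟩ ≈ʳ 0ʳ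
      -- Here `ℕ.≤-refl` states that a cluster, an apex with r - 2 spokes, has fewer than r entries.
      cluster-vanishes s = all-vanish ℕ.≤-refl a a≉0 (position ∘ cluster s)
        (λ i u → ⟨ normal i ∙ X (cluster s u) ⟩)
        (λ u → ∙-sumˡ a normal (X (cluster s u)) relation)
        (λ u l l≢pred l≢ → begin
          ⟨ normal l ∙ X (cluster s u) ⟩
            ≈⟨ proj₂ (proj₂ (proj₁ equi (cluster s u))) l l≢pred l≢ ⟩
          offset l
            ≈⟨ offset≈0 l ⟩
          0ʳ ∎)
        (λ u → 0≤-shift {offset (position (cluster s u))}
                 {⟨ normal (position (cluster s u)) ∙ X (cluster s u) ⟩}
                 (proj₁ (proj₂ (proj₁ equi (cluster s u)))) (offset≈0 (position (cluster s u))))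
        (balanced s)

      simplex-vanishes : ∀ p → ⟨ normal (cyclicPred zero) ∙ simplex p ⟩ ≈ʳ 0ʳ
      simplex-vanishes p =
        [ (λ p<σ → small⇒0 p p<σ (cyclicPred zero))
        , (λ { (s , v , refl) → subst (λ x → ⟨ normal (cyclicPred zero) ∙ x ⟩ ≈ʳ 0ʳ)
            (lookup-++ˡ simplex apexes (spoke s v)) (cluster-vanishes s zero (suc v)) })
        ]′ (spoke-split W≤ p)

      impossible : ⊥
      impossible = RealHyperplane.nonzero (H (cyclicPred zero))
        (affine-vanishing (normal (cyclicPred zero)) 0ʳ simplex-vanishes)

    -- Dependence is a negated statement, so independence of all r normals has to be derived. A
    -- relation with one nonzero coefficient has only nonzero ones, as any r - 1 normals are
    -- independent, and `impossible` excludes such a relation.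
    not-equidistributed : ⊥
    not-equidistributed = dependent λ a relation l → ≈ʳ-stable {a l} {0ʳ} λ al≉0 →
      impossible a
        (λ k ak≈0 → al≉0 (relation-vanishes normal k
          (independent (punchIn k) (λ {x} {y} → punchIn-injective k x y)) a relation ak≈0 l))
        relation

-- The complex configuration

sumᶜ-re : ∀ {D} (f : Fin D → ℂ) → re (sumᶜ f) ≡ sumʳ (re ∘ f)
sumᶜ-re {zero}  f = refl
sumᶜ-re {suc D} f = cong (re (f zero) +ʳ_) (sumᶜ-re (f ∘ suc))

sumᶜ-im : ∀ {D} (f : Fin D → ℂ) → im (sumᶜ f) ≡ sumʳ (im ∘ f)
sumᶜ-im {zero}  f = refl
sumᶜ-im {suc D} f = cong (im (f zero) +ʳ_) (sumᶜ-im (f ∘ suc))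

simplexᶜ : ∀ {D} → Fin (suc D) → ℂ^ D
simplexᶜ p i = fromReal (simplex p i)

re-simplexᶜ : ∀ {D} (α : ℂ^ D) p → re ⟨ α , simplexᶜ p ⟩ᶜ ≈ʳ ⟨ re ∘ α ∙ simplex p ⟩
re-simplexᶜ α p = begin
  re ⟨ α , simplexᶜ p ⟩ᶜ
    ≡⟨ sumᶜ-re (λ i → α i *ᶜ conj (simplexᶜ p i)) ⟩
  sumʳ (λ i → re (α i) *ʳ simplex p i +ʳ -ʳ (im (α i) *ʳ -ʳ 0ʳ))
    ≈⟨ re-∙ (re ∘ α) (im ∘ α) (simplex p) (λ _ → 0ʳ) (λ _ → ≈ʳ.refl {0ʳ}) ⟩
  ⟨ re ∘ α ∙ simplex p ⟩ ∎

im-simplexᶜ : ∀ {D} (α : ℂ^ D) p → im ⟨ α , simplexᶜ p ⟩ᶜ ≈ʳ ⟨ im ∘ α ∙ simplex p ⟩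
im-simplexᶜ α p = begin
  im ⟨ α , simplexᶜ p ⟩ᶜ
    ≡⟨ sumᶜ-im (λ i → α i *ᶜ conj (simplexᶜ p i)) ⟩
  sumʳ (λ i → re (α i) *ʳ -ʳ 0ʳ +ʳ im (α i) *ʳ simplex p i)
    ≈⟨ im-∙-real (re ∘ α) (im ∘ α) (simplex p) (λ _ → 0ʳ) (λ _ → ≈ʳ.refl {0ʳ}) ⟩
  ⟨ im ∘ α ∙ simplex p ⟩ ∎

simplexᶜ++-spanning : ∀ {D e} (b : Fin e → ℂ^ D) → ComplexAffinelySpanning (simplexᶜ ++ b)
simplexᶜ++-spanning {e = e} b (H , on) = nonzero λ c →
  affine-vanishing (re ∘ α) (re β) (λ p → begin
    ⟨ re ∘ α ∙ simplex p ⟩    ≈⟨ re-simplexᶜ α p ⟨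
    re ⟨ α , simplexᶜ p ⟩ᶜ    ≈⟨ proj₁ (on-simplex p) ⟩
    re β                      ∎) c ,
  affine-vanishing (im ∘ α) (im β) (λ p → begin
    ⟨ im ∘ α ∙ simplex p ⟩    ≈⟨ im-simplexᶜ α p ⟨
    im ⟨ α , simplexᶜ p ⟩ᶜ    ≈⟨ proj₂ (on-simplex p) ⟩
    im β                      ∎) c
  where
  open ComplexHyperplane H
  on-simplex : ∀ p → simplexᶜ p ∈ points
  on-simplex p = subst (_∈ points) (lookup-++ˡ simplexᶜ b p) (on (p ↑ˡ e))

module ComplexConstruction (μ D e : ℕ) where

  -- For r = 2 the small classes are m - 1 singletons; the factor 1 in `σ` is the block length of
  -- `color`.
  N σ : ℕ
  N = suc (suc D) + e
  σ = (1 + μ) * 1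

  twin : Fin e → Fin (suc (suc D))
  twin s = vertex (σ + toℕ s)

  -- A marking by real parts, which makes the points distinct as in the real case. Once the
  -- functional is known to have real coefficients, the shift does not affect imaginary parts.
  shift : Fin e → ℝ^ (suc D)
  shift s i = ι (ℕ→ℚ (2 + toℕ s)) *ʳ simplex (suc zero) i

  extra : Fin e → ℂ^ (suc D)
  extra s i = shift s i +i simplex (twin s) i

  X : Fin N → ℂ^ (suc D)
  X = simplexᶜ ++ extra

  color : Fin N → Fin (2 + μ)
  color = blocks (1 + μ) 1

  re-X : ∀ p → (λ i → re (X p i)) ≡ (simplex ++ shift) p
  re-X p with splitAt (suc (suc D)) p
  ... | inj₁ _ = refl
  ... | inj₂ _ = refl

  X-distinct : Distinctᶜ X
  X-distinct {p} {q} X≋ = simplex++-distinct shift (λ s → ≈ʳ.*-identityʳ (ι (ℕ→ℚ (2 + toℕ s))))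
    (subst₂ _≋ʳ_ (re-X p) (re-X q) (proj₁ ∘ X≋))

  module _ (W≤ : suc (suc D) ∸ σ ≤ e) (H : ComplexHyperplane (suc D))
           (equi : Equidistributes (complexRegular2Fan H) X color) where

    open ComplexHyperplane H

    -- Both halves lie in one real hyperplane, since their points differ from the center by a real
    -- number in the value of the functional.
    im-X : ∀ p → im ⟨ α , X p ⟩ᶜ ≈ʳ im β
    im-X p = begin
      im ⟨ α , X p ⟩ᶜ    ≈⟨ proj₂ (proj₂ (proj₂ (proj₂ (proj₁ equi p)))) ⟩
      im β +ʳ 0ʳ         ≈⟨ ≈ʳ.+-identityʳ (im β) ⟩
      im β               ∎

    -- On the real simplex points, the imaginary part of the functional is the real functional with
    -- coefficients `im ∘ α`, and it is constant there.
    im-α≈0 : ∀ c → im (α c) ≈ʳ 0ʳ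
    im-α≈0 = affine-vanishing (im ∘ α) (im β) λ p → begin
      ⟨ im ∘ α ∙ simplex p ⟩     ≈⟨ im-simplexᶜ α p ⟨
      im ⟨ α , simplexᶜ p ⟩ᶜ     ≡⟨ cong (λ x → im ⟨ α , x ⟩ᶜ) (lookup-++ˡ simplexᶜ extra p) ⟨
      im ⟨ α , X (p ↑ˡ e) ⟩ᶜ     ≈⟨ im-X (p ↑ˡ e) ⟩
      im β                       ∎

    im-β≈0 : im β ≈ʳ 0ʳ
    im-β≈0 = begin
      im β                                        ≈⟨ im-X zero ⟨
      im ⟨ α , simplexᶜ zero ⟩ᶜ                   ≈⟨ im-simplexᶜ α zero ⟩
      ⟨ im ∘ α ∙ simplex zero ⟩                   ≈⟨ ∙-origin (im ∘ α) ⟩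
      0ʳ                                          ∎

    small⇒re : ∀ p → toℕ p < σ → ⟨ re ∘ α ∙ simplex p ⟩ ≈ʳ re β
    small⇒re p p<σ = begin
      ⟨ re ∘ α ∙ simplex p ⟩     ≈⟨ re-simplexᶜ α p ⟨
      re ⟨ α , simplexᶜ p ⟩ᶜ     ≡⟨ cong (λ x → re ⟨ α , x ⟩ᶜ) (lookup-++ˡ simplexᶜ extra p) ⟨
      re ⟨ α , X (p ↑ˡ e) ⟩ᶜ     ≈⟨ ≈ʳ-stable {re ⟨ α , X (p ↑ˡ e) ⟩ᶜ} {re β} (λ ¬on →
                                      small-class⇒center (complexRegular2Fan H) {X} {color} equi (p ↑ˡ e)
                                        (s≤s (∣block∣≤ (1 + μ) 1 (p ↑ˡ e)
                                          (subst (_< σ) (sym (toℕ-↑ˡ p e)) p<σ)))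
                                        (¬on ∘ proj₁)) ⟩
      re β                       ∎

    re-β≈0 : re β ≈ʳ 0ʳ
    re-β≈0 = begin
      re β                       ≈⟨ small⇒re zero (s≤s z≤n) ⟨
      ⟨ re ∘ α ∙ simplex zero ⟩  ≈⟨ ∙-origin (re ∘ α) ⟩
      0ʳ                         ∎

    -- The imaginary part at the extra point is zero, and for real `α` it is minus the real
    -- functional at the twin vertex.
    twin⇒0 : ∀ s → ⟨ re ∘ α ∙ simplex (twin s) ⟩ ≈ʳ 0ʳ
    twin⇒0 s = im-∙-vanishing (re ∘ α) (im ∘ α) (shift s) (simplex (twin s)) im-α≈0 (begin
      sumʳ (λ i → re (α i) *ʳ -ʳ simplex (twin s) i +ʳ im (α i) *ʳ shift s i)
        ≡⟨ sumᶜ-im (λ i → α i *ᶜ conj (extra s i)) ⟨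
      im ⟨ α , extra s ⟩ᶜ
        ≡⟨ cong (λ x → im ⟨ α , x ⟩ᶜ) (lookup-++ʳ simplexᶜ extra s) ⟨
      im ⟨ α , X (suc (suc D) ↑ʳ s) ⟩ᶜ
        ≈⟨ im-X (suc (suc D) ↑ʳ s) ⟩
      im β
        ≈⟨ im-β≈0 ⟩
      0ʳ ∎)

    re-simplex≈0 : ∀ p → ⟨ re ∘ α ∙ simplex p ⟩ ≈ʳ 0ʳ
    re-simplex≈0 p = [ small⇒0 , (λ { (s , refl) → twin⇒0 s }) ]′ (vertex-split σ e W≤ p)
      where
      small⇒0 : toℕ p < σ → ⟨ re ∘ α ∙ simplex p ⟩ ≈ʳ 0ʳ
      small⇒0 p<σ = begin
        ⟨ re ∘ α ∙ simplex p ⟩   ≈⟨ small⇒re p p<σ ⟩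
        re β                     ≈⟨ re-β≈0 ⟩
        0ʳ                       ∎

    not-equidistributed : ⊥
    not-equidistributed = nonzero λ c →
      affine-vanishing (re ∘ α) 0ʳ re-simplex≈0 c , im-α≈0 c

-- The theorem in terms of its numerical parameters

real-example : ∀ ρ μ W n d ℓ {D} → n ∸ d ∸ 1 ≡ suc D → n + ℓ ≡ suc (suc D) + (d + ℓ) →
  suc (suc D) ≡ (1 + μ) * (2 + ρ) + suc W → suc W ≤ (d + ℓ) * (1 + ρ) →
  Σ[ X ∈ (Fin (n + ℓ) → ℝ^ (n ∸ d ∸ 1)) ]
    (Distinctʳ X × AffinelySpanning X ×
      Σ[ c ∈ (Fin (n + ℓ) → Fin (2 + μ)) ]
        (IsColoring c ×
          ((F : ConicalArrangement (3 + ρ) (n ∸ d ∸ 1)) →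
            ¬ Equidistributes (ConicalArrangement.fan F) X c)))
-- Dimension and number of points enter through equations, so that rewriting puts them in the
-- successor form of the construction. The `suc W` vertices beyond `σ` leave at least one point for
-- the last color.
real-example ρ μ W n d ℓ {D} D≡ N≡ 1+D≡ W≤ rewrite D≡ | N≡ =
  X , simplex++-distinct apexes apexes-zero , simplex++-spanning apexes ,
  color , blocks-isColoring (1 + μ) (2 + ρ)
    (ℕ.<-≤-trans (subst (σ <_) (sym 1+D≡) (ℕ.m<m+n σ (s≤s z≤n))) (ℕ.m≤m+n _ (d + ℓ))) ,
  not-equidistributed (subst (_≤ (d + ℓ) * (1 + ρ))
    (sym (trans (cong (_∸ σ) 1+D≡) (ℕ.m+n∸m≡n σ (suc W)))) W≤)
  where open RealConstruction ρ μ D (d + ℓ)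

complex-example : ∀ μ W n d ℓ {D} → n ∸ d ∸ 1 ≡ suc D → n + ℓ ≡ suc (suc D) + (d + ℓ) →
  suc (suc D) ≡ (1 + μ) * 1 + suc W → suc W ≤ d + ℓ →
  Σ[ X ∈ (Fin (n + ℓ) → ℂ^ (n ∸ d ∸ 1)) ]
    (Distinctᶜ X × ComplexAffinelySpanning X ×
      Σ[ c ∈ (Fin (n + ℓ) → Fin (2 + μ)) ]
        (IsColoring c ×
          ((H : ComplexHyperplane (n ∸ d ∸ 1)) →
            ¬ Equidistributes (complexRegular2Fan H) X c)))
complex-example μ W n d ℓ {D} D≡ N≡ 1+D≡ W≤ rewrite D≡ | N≡ =
  X , X-distinct , simplexᶜ++-spanning extra ,
  color , blocks-isColoring (1 + μ) 1
    (ℕ.<-≤-trans (subst (σ <_) (sym 1+D≡) (ℕ.m<m+n σ (s≤s z≤n))) (ℕ.m≤m+n _ (d + ℓ))) ,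
  not-equidistributed (subst (_≤ d + ℓ)
    (sym (trans (cong (_∸ σ) 1+D≡) (ℕ.m+n∸m≡n σ (suc W)))) W≤)
  where open ComplexConstruction μ D (d + ℓ)

proposition8p4 : (d m : ℕ) → 1 ≤ d → 2 ≤ m →
    ((r k ℓ : ℕ) → (3≤r : 3 ≤ r) →
    (+ 2 / 1) +ℚ (_/_ (+ (k + 2)) (r ∸ 2) {{>-nonZero (m<n⇒0<n∸m 3≤r)}}) <ℚ (+ ℓ / 1) →
    let n = (r ∸ 1) * (d + m + 1) + k + 1 in
    Σ[ X ∈ (Fin (n + ℓ) → ℝ^ (n ∸ d ∸ 1)) ]
    (Distinctʳ X × AffinelySpanning X ×
    Σ[ c ∈ (Fin (n + ℓ) → Fin m) ]
    (IsColoring c ×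
    ((F : ConicalArrangement r (n ∸ d ∸ 1)) →
    ¬ Equidistributes (ConicalArrangement.fan F) X c))))
    × ((k ℓ : ℕ) → k + 3 < ℓ →
    let n = 2 * (d + 1) + m + k in
    Σ[ X ∈ (Fin (n + ℓ) → ℂ^ (n ∸ d ∸ 1)) ]
    (Distinctᶜ X × ComplexAffinelySpanning X ×
    Σ[ c ∈ (Fin (n + ℓ) → Fin m) ]
    (IsColoring c ×
    ((H : ComplexHyperplane (n ∸ d ∸ 1)) →
    ¬ Equidistributes (complexRegular2Fan H) X c))))
proposition8p4 d (suc (suc μ)) 1≤d (s≤s (s≤s z≤n)) = real , complex
  where
  open ℕ.+-*-Solver
  real : (r k ℓ : ℕ) (3≤r : 3 ≤ r) → _
  real (suc (suc (suc ρ))) k ℓ (s≤s (s≤s (s≤s z≤n))) ℓ> =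
    -- The simplex has n - d vertices, of which (r - 1)(m - 1) are in the small classes; the
    -- successor of this value of `W` is the number of the others.
    real-example ρ μ (suc ρ * d + (2 * suc ρ + k + 2))
      (suc (suc ρ) * (d + suc (suc μ) + 1) + k + 1) d ℓ (∸-∸-shift n≡) (+-shift ℓ n≡) 1+D≡
      (spokes-suffice ρ d k ℓ (clear-denominators ρ k ℓ ℓ>))
    where
    n≡ : suc (suc ρ) * (d + suc (suc μ) + 1) + k + 1 ≡
         d + (1 + suc (suc μ * suc (suc ρ) + (suc ρ * d + (2 * suc ρ + k + 1))))
    n≡ = solve 4 (λ ρ d μ k →
      (con 2 :+ ρ) :* (d :+ (con 2 :+ μ) :+ con 1) :+ k :+ con 1 :=
      d :+ (con 1 :+ (con 1 :+ ((con 1 :+ μ) :* (con 2 :+ ρ) :+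
        ((con 1 :+ ρ) :* d :+ (con 2 :* (con 1 :+ ρ) :+ k :+ con 1)))))) refl ρ d μ k
    1+D≡ : suc (suc (suc μ * suc (suc ρ) + (suc ρ * d + (2 * suc ρ + k + 1)))) ≡
           suc μ * suc (suc ρ) + suc (suc ρ * d + (2 * suc ρ + k + 2))
    1+D≡ = solve 3 (λ σ x y →
      con 2 :+ (σ :+ (x :+ (y :+ con 1))) := σ :+ (con 1 :+ (x :+ (y :+ con 2)))) refl
      (suc μ * suc (suc ρ)) (suc ρ * d) (2 * suc ρ + k)
  complex : (k ℓ : ℕ) → k + 3 < ℓ → _
  -- Here n - d = d + m + k + 2, and without the m - 1 singleton classes d + k + 3 vertices remain,
  -- each of which needs its own extra point.
  complex k ℓ k+3<ℓ = complex-example μ (d + (k + 2))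
    (2 * (d + 1) + suc (suc μ) + k) d ℓ (∸-∸-shift n≡) (+-shift ℓ n≡) 1+D≡ W≤
    where
    n≡ : 2 * (d + 1) + suc (suc μ) + k ≡ d + (1 + suc (suc μ + (d + (k + 1))))
    n≡ = solve 3 (λ d μ k → con 2 :* (d :+ con 1) :+ (con 2 :+ μ) :+ k :=
      d :+ (con 1 :+ (con 1 :+ (con 1 :+ μ :+ (d :+ (k :+ con 1)))))) refl d μ k
    1+D≡ : suc (suc (suc μ + (d + (k + 1)))) ≡ suc μ * 1 + suc (d + (k + 2))
    1+D≡ = solve 3 (λ d μ k → con 2 :+ (con 1 :+ μ :+ (d :+ (k :+ con 1))) :=
      (con 1 :+ μ) :* con 1 :+ (con 1 :+ (d :+ (k :+ con 2)))) refl d μ k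
    W≤ : suc (d + (k + 2)) ≤ d + ℓ
    W≤ = ℕ.≤-trans (ℕ.≤-reflexive (solve 2 (λ d k →
      con 1 :+ (d :+ (k :+ con 2)) := d :+ (k :+ con 3)) refl d k)) (ℕ.+-monoʳ-≤ d (ℕ.<⇒≤ k+3<ℓ))
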